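{- If a graph $G$ has a clean binary pear tree $(T, \mathcal{B})$, then $G$ has a minor $H$ such that $H$ has a clean binary ear tree $(T, \mathcal{P})$ (indexed by the same binary tree $T$).
   Context: All graphs are finite and simple; after contracting an edge, parallel edges and loops are suppressed. The length of a path is its number of edges. If $H$ is a subgraph of $G$, an $H$-ear is a path in $G$ with both ends in $V(H)$ and no internal vertex in $V(H)$. A binary tree is a rooted tree in which every vertex has at most two children; $T_x$ denotes the subtree rooted at $x$. A binary ear tree in $G$ is a pair $(T,\mathcal{P})$ with $T$ a binary tree and $\mathcal{P}=\{P_x:x\in V(T)\}$ paths in $G$ of length at least $2$ such that for every non-root $x$ with parent $y$: $P_x$ is a $P_y$-ear, and no internal vertex of $P_x$ lies in $\bigcup_{z\in V(T)\setminus V(T_x)}V(P_z)$; it is clean if for every non-leaf $y$ some end of $P_y$ is not contained in any $P_x$ with $x$ a child of $y$. A binary pear tree in $G$ is a pair $(T,\mathcal{B})$ with $T$ a binary tree and $\mathcal{B}=\{(P_x,Q_x):x\in V(T)\}$ pairs of paths in $G$ of length at least $2$ with $P_x\subseteq Q_x$, such that for every non-root $x$ with parent $y$: (1) $Q_x$ is a $P_y$-ear; (2) if $x$ has no sibling, no internal vertex of $Q_x$ lies in $\bigcup_{z\in V(T)\setminus V(T_x)}V(Q_z)$; (3) if $x$ has a sibling $x'$, then no internal vertex of $Q_x$ lies in $\bigcup_{z\in V(T)\setminus(V(T_x)\cup V(T_{x'}))}V(Q_z)$, and no internal vertex of $P_x$ lies in $Q_{x'}$. It is clean if for every non-leaf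 $y$ of $T$ some end of $P_y$ is not contained in any $Q_x$ with $x$ a child of $y$. -}

module Defs where

open import Data.Nat using (ℕ; suc; _≤_)
open import Data.Fin using (Fin)
open import Data.Bool using (Bool; T; false)
open import Data.Maybe using (Maybe; just)
open import Data.List using (List; []; _∷_; _++_; [_]; length)
open import Data.List.Membership.Propositional using (_∈_)
open import Data.List.Relation.Unary.Unique.Propositional using (Unique)
open import Data.Product using (Σ; ∃; ∃-syntax; _×_)
open import Data.Sum using (_⊎_)
open import Relation.Nullary using (¬_)
open import Relation.Binary.PropositionalEquality using (_≡_)

record Graph : Set where
  field
    n     : ℕ
    adj   : Fin n → Fin n → Bool
    sym   : ∀ u v → adj u v ≡ adj v u
    irr   : ∀ v → adj v v ≡ false

open Graph public

V : Graph → Set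
V G = Fin (n G)

E : (G : Graph) → V G → V G → Set
E G u v = T (adj G u v)

-- Minors (Diestel's model definition): each vertex of G is sent to at
-- most one branch set (disjointness); each branch set is nonempty and
-- connected in G; every edge uw of H is realised by an edge of G
-- between the branch sets of u and w.

data WalkIn (G : Graph) (S : V G → Set) : V G → V G → Set where
  stop : ∀ {a} → S a → WalkIn G S a a
  step : ∀ {a b c} → S a → E G a b → WalkIn G S b c → WalkIn G S a c

record MinorModel (H G : Graph) : Set where
  field
    φ        : V G → Maybe (V H)
    nonempty : ∀ (u : V H) → ∃[ a ] (φ a ≡ just u)
    connected : ∀ (u : V H) (a b : V G) → φ a ≡ just u → φ b ≡ just u →
                WalkIn G (λ c → φ c ≡ just u) a b
    edges    : ∀ (u w : V H) → E H u w →
               ∃[ a ] ∃[ b ] (φ a ≡ just u × φ b ≡ just w × E G a b)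

_≼_ : Graph → Graph → Set
H ≼ G = MinorModel H G

data Consec {A : Set} : List A → A → A → Set where
  here  : ∀ {u v xs} → Consec (u ∷ v ∷ xs) u v
  there : ∀ {x xs u v} → Consec xs u v → Consec (x ∷ xs) u v

EdgeIn : {A : Set} → List A → A → A → Set
EdgeIn xs u v = Consec xs u v ⊎ Consec xs v u

record Path (G : Graph) : Set where
  field
    start : V G
    inner : List (V G)
    end   : V G
  verts : List (V G)
  verts = start ∷ inner ++ [ end ]
  field
    unique : Unique verts
    linked : ∀ u v → Consec verts u v → E G u v

open Path public

len : {G : Graph} → Path G → ℕ
len P = suc (length (inner P))

_∈V_ : {G : Graph} → V G → Path G → Set
v ∈V P = v ∈ verts P

IsEnd : {G : Graph} → V G → Path G → Set
IsEnd v P = v ≡ start P ⊎ v ≡ end P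

_∈I_ : {G : Graph} → V G → Path G → Set
v ∈I P = v ∈ inner P

_⊆P_ : {G : Graph} → Path G → Path G → Set
P ⊆P Q = (∀ v → v ∈V P → v ∈V Q) ×
         (∀ u v → Consec (verts P) u v → EdgeIn (verts Q) u v)

IsEar : {G : Graph} → Path G → Path G → Set
IsEar P R = start P ∈V R × end P ∈V R × (∀ v → v ∈I P → ¬ (v ∈V R))

-- Rooted binary trees (each vertex has 0, 1 or 2 children; children
-- unordered in the paper, the order here is immaterial).

data BTree : Set where
  lf : BTree
  un : BTree → BTree
  bi : BTree → BTree → BTree

data Pos : BTree → Set where
  here : ∀ {t} → Pos t
  inU  : ∀ {t} → Pos t → Pos (un t)
  inL  : ∀ {l r} → Pos l → Pos (bi l r)
  inR  : ∀ {l r} → Pos r → Pos (bi l r)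

data Child : {t : BTree} → Pos t → Pos t → Set where
  cU  : ∀ {t} → Child {un t} (inU here) here
  cL  : ∀ {l r} → Child {bi l r} (inL here) here
  cR  : ∀ {l r} → Child {bi l r} (inR here) here
  uU  : ∀ {t} {x y : Pos t} → Child x y → Child (inU x) (inU y)
  uL  : ∀ {l r} {x y : Pos l} → Child x y → Child {bi l r} (inL x) (inL y)
  uR  : ∀ {l r} {x y : Pos r} → Child x y → Child {bi l r} (inR x) (inR y)

data Sib : {t : BTree} → Pos t → Pos t → Set where
  sLR : ∀ {l r} → Sib {bi l r} (inL here) (inR here)
  sRL : ∀ {l r} → Sib {bi l r} (inR here) (inL here)
  tU  : ∀ {t} {x y : Pos t} → Sib x y → Sib (inU x) (inU y)
  tL  : ∀ {l r} {x y : Pos l} → Sib x y → Sib {bi l r} (inL x) (inL y)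
  tR  : ∀ {l r} {x y : Pos r} → Sib x y → Sib {bi l r} (inR x) (inR y)

data InSub : {t : BTree} → Pos t → Pos t → Set where
  top : ∀ {t} {z : Pos t} → InSub here z
  dU  : ∀ {t} {x z : Pos t} → InSub x z → InSub (inU x) (inU z)
  dL  : ∀ {l r} {x z : Pos l} → InSub x z → InSub {bi l r} (inL x) (inL z)
  dR  : ∀ {l r} {x z : Pos r} → InSub x z → InSub {bi l r} (inR x) (inR z)

IsEarTree : (G : Graph) (t : BTree) → (Pos t → Path G) → Set
IsEarTree G t P =
  (∀ x → 2 ≤ len (P x)) ×
  (∀ x y → Child x y →
     IsEar (P x) (P y) ×
     (∀ v → v ∈I P x → ∀ z → ¬ InSub x z → ¬ (v ∈V P z)))

CleanEar : (G : Graph) (t : BTree) → (Pos t → Path G) → Set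
CleanEar G t P =
  ∀ y → (∃[ x ] Child x y) →
    ∃[ e ] (IsEnd e (P y) × (∀ x → Child x y → ¬ (e ∈V P x)))

IsPearTree : (G : Graph) (t : BTree) → (Pos t → Path G) → (Pos t → Path G) → Set
IsPearTree G t P Q =
  (∀ x → 2 ≤ len (P x) × 2 ≤ len (Q x) × P x ⊆P Q x) ×
  (∀ x y → Child x y →
     IsEar (Q x) (P y) ×
     ((∀ x' → ¬ Sib x x') →
        ∀ v → v ∈I Q x → ∀ z → ¬ InSub x z → ¬ (v ∈V Q z)) ×
     (∀ x' → Sib x x' →
        (∀ v → v ∈I Q x → ∀ z → ¬ InSub x z → ¬ InSub x' z → ¬ (v ∈V Q z)) ×
        (∀ v → v ∈I P x → ¬ (v ∈V Q x'))))

CleanPear : (G : Graph) (t : BTree) → (Pos t → Path G) → (Pos t → Path G) → Set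
CleanPear G t P Q =
  ∀ y → (∃[ x ] Child x y) →
    ∃[ e ] (IsEnd e (P y) × (∀ x → Child x y → ¬ (e ∈V Q x)))

{-# OPTIONS --safe #-}
module Submission where

-- For a child x of y, cutting P x out of Q x leaves two disjoint tails that lead from the ends of
-- P x to P y. If they were contracted to points, P x itself would become an ear of P y; but the
-- tails of x may cross those of its sibling x′. Let a c be the first edge of a tail of x, with a on
-- P y. If c is on no tail of x′, contract a c. If it is on one, contract a c and shorten that tail
-- so that it starts at the merged vertex. This fails only when the other tail of x′ starts at a,
-- since then the tails of x′ would meet. In that case P y is rerouted: between a and the start a′
-- of the tail of x′ through c, it now follows that tail from a′ to c and then the edge c a. A tail
-- of x that started on the part of P y cut out is prolonged along that part to a′. In every case
-- the total length of P y and the four tails drops. The moves at y disturb neither the subtrees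
-- below (beyond the ends of their root paths) nor anything outside the subtree of y, so the tree
-- can be treated from the leaves up; all contractions are recorded in one idempotent map
-- f : V G → V G with connected fibres, and H is its quotient.

open import Defs
open import Data.Nat using (ℕ; zero; suc; _+_; _≤_; _<_; z≤n; s≤s)
open import Data.Nat.Properties
  using (≤-refl; ≤-trans; ≤-reflexive; +-mono-≤; +-monoʳ-≤; +-monoˡ-≤; +-comm;
         m≤n+m; m≤m+n; n≤1+n; suc-injective)
open import Data.Nat.Tactic.RingSolver using (solve-∀)
open import Data.Fin using (Fin; zero; suc; _≟_)
open import Data.Fin.Properties using (any?)
open import Data.Bool using (T; T?; false)
open import Data.Maybe using (just)
open import Data.Empty using (⊥; ⊥-elim)
open import Data.List using (List; []; _∷_; _++_; [_]; length; map; reverse)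
open import Data.List.Properties
  using (++-assoc; length-++; unfold-reverse; length-reverse; reverse-++; length-map; map-++)
open import Data.List.Membership.Propositional using (_∈_; _∉_)
open import Data.List.Membership.Propositional.Properties
  using (∈-++⁺ˡ; ∈-++⁺ʳ; ∈-++⁻; ∈-∃++; ∈-map⁺; ∈-map⁻)
open import Data.List.Relation.Unary.Any using (here; there)
open import Data.List.Relation.Unary.Any.Properties using (reverse⁺; reverse⁻)
import Data.List.Relation.Unary.All as All
open import Data.List.Relation.Unary.All.Properties using (¬Any⇒All¬; ++⁻ˡ; ++⁻ʳ)
open import Data.List.Relation.Unary.AllPairs using ([]; _∷_)
open import Data.List.Relation.Unary.Unique.Propositional using (Unique)
open import Data.List.Relation.Unary.Unique.Propositional.Properties
  using (Unique[x∷xs]⇒x∉xs) renaming (++⁺ to unique-++⁺)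
open import Data.List.Relation.Binary.Disjoint.Propositional using (Disjoint)
open import Data.List.Relation.Binary.Permutation.Propositional using (↭-sym; ↭⇒↭ₛ)
open import Data.List.Relation.Binary.Permutation.Propositional.Properties using (↭-reverse)
open import Data.List.Relation.Binary.Permutation.Setoid.Properties using (Unique-resp-↭)
open import Data.Product using (Σ; ∃; ∃-syntax; _×_; _,_; proj₁; proj₂)
open import Data.Sum using (_⊎_; inj₁; inj₂; [_,_]′)
open import Function using (_∘_; id)
open import Relation.Nullary using (¬_; Dec; yes; no; ¬?; _×-dec_)
open import Relation.Nullary.Decidable using (⌊_⌋; toWitness; fromWitness)
open import Relation.Binary.Definitions using (DecidableEquality)
open import Relation.Binary.PropositionalEquality
  using (_≡_; _≢_; refl; trans; cong; subst; subst₂; setoid)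
  renaming (sym to ≡-sym)
open Relation.Binary.PropositionalEquality.≡-Reasoning

-- Duplicate-free lists

unique-∷ : ∀ {A : Set} {x : A} {xs} → x ∉ xs → Unique xs → Unique (x ∷ xs)
unique-∷ x∉xs u = ¬Any⇒All¬ _ x∉xs ∷ u

unique-++⁻ : ∀ {A : Set} (xs : List A) {ys} → Unique (xs ++ ys) →
             Unique xs × Unique ys × Disjoint xs ys
unique-++⁻ [] u = [] , u , λ ()
unique-++⁻ (x ∷ xs) (p ∷ u) with unique-++⁻ xs u
... | uxs , uys , d = ++⁻ˡ xs p ∷ uxs , uys ,
  λ { (here refl , m) → All.lookup (++⁻ʳ xs p) m refl ; (there q , m) → d (q , m) }

unique-reverse : ∀ {A : Set} {xs : List A} → Unique xs → Unique (reverse xs)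
unique-reverse {A} {xs} = Unique-resp-↭ (setoid A) (↭⇒↭ₛ (↭-sym (↭-reverse xs)))

unique-map : ∀ {A B : Set} (h : A → B) {xs} →
             (∀ {u v} → u ∈ xs → v ∈ xs → h u ≡ h v → u ≡ v) →
             Unique xs → Unique (map h xs)
unique-map h {[]} inj u = []
unique-map h {x ∷ xs} inj u@(_ ∷ u′) = unique-∷
  (λ m → let (y , y∈ , eq) = ∈-map⁻ h m in
         Unique[x∷xs]⇒x∉xs u (subst (_∈ xs) (≡-sym (inj (here refl) (there y∈) eq)) y∈))
  (unique-map h (λ p q → inj (there p) (there q)) u′)

-- Walks along a relation

-- Walk _~_ s xs t is a walk from s to t whose vertices after s are xs.
data Walk {A : Set} (_~_ : A → A → Set) : A → List A → A → Set where
  nil  : ∀ {a} → Walk _~_ a [] a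
  cons : ∀ {a b c xs} → a ~ b → Walk _~_ b xs c → Walk _~_ a (b ∷ xs) c

module _ {A : Set} {_~_ : A → A → Set} where

  walk-last : ∀ {s xs t} → Walk _~_ s xs t → t ∈ s ∷ xs
  walk-last nil = here refl
  walk-last (cons _ w) = there (walk-last w)

  walk-last-≢ : ∀ {s xs t} → Walk _~_ s xs t → s ≢ t → t ∈ xs
  walk-last-≢ w s≢t with walk-last w
  ... | here eq = ⊥-elim (s≢t (≡-sym eq))
  ... | there m = m

  walk-++ : ∀ {s xs u ys t} → Walk _~_ s xs u → Walk _~_ u ys t → Walk _~_ s (xs ++ ys) t
  walk-++ nil v = v
  walk-++ (cons e w) v = cons e (walk-++ w v)

  walk-split : ∀ {s t v} ys {zs} → Walk _~_ s (ys ++ v ∷ zs) t →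
               Walk _~_ s (ys ++ [ v ]) v × Walk _~_ v zs t
  walk-split [] (cons e w) = cons e nil , w
  walk-split (y ∷ ys) (cons e w) = let (w₁ , w₂) = walk-split ys w in cons e w₁ , w₂

  walk-at : ∀ {s xs t v} → v ∈ s ∷ xs → Walk _~_ s xs t →
            ∃[ ys ] ∃[ zs ] (xs ≡ ys ++ zs × Walk _~_ s ys v × Walk _~_ v zs t)
  walk-at (here refl) w = [] , _ , refl , nil , w
  walk-at (there m) (cons e w) with walk-at m w
  ... | ys , zs , refl , w₁ , w₂ = _ ∷ ys , zs , refl , cons e w₁ , w₂

  walk-reverse : (∀ {u v} → u ~ v → v ~ u) → ∀ {s xs t} → Walk _~_ s xs t →
                 ∃[ ys ] (t ∷ ys ≡ reverse (s ∷ xs) × Walk _~_ t ys s)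
  walk-reverse sy nil = [] , refl , nil
  walk-reverse sy {s} {b ∷ xs} (cons e w) with walk-reverse sy w
  ... | ys , eq , w′ = ys ++ [ s ] ,
    trans (cong (_++ [ s ]) eq) (≡-sym (unfold-reverse s (b ∷ xs))) ,
    walk-++ w′ (cons (sy e) nil)

walk-map : ∀ {A B : Set} {_~_ : A → A → Set} {_≈_ : B → B → Set} (h : A → B) {s xs t} →
           (∀ {u v} → u ∈ s ∷ xs → v ∈ s ∷ xs → u ~ v → h u ≈ h v) →
           Walk _~_ s xs t → Walk _≈_ (h s) (map h xs) (h t)
walk-map h k nil = nil
walk-map h k (cons e w) =
  cons (k (here refl) (there (here refl)) e) (walk-map h (λ p q → k (there p) (there q)) w)

walk-⇒ : ∀ {A : Set} {_~_ _≈_ : A → A → Set} {s xs t} →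
         (∀ {u v} → u ∈ s ∷ xs → v ∈ s ∷ xs → u ~ v → u ≈ v) →
         Walk _~_ s xs t → Walk _≈_ s xs t
walk-⇒ k nil = nil
walk-⇒ k (cons e w) =
  cons (k (here refl) (there (here refl)) e) (walk-⇒ (λ p q → k (there p) (there q)) w)

-- Final pieces of walks and their last vertex on a given list

-- The heads c and d stay apart from the lists because walks are given that way; `front` may be
-- empty, and then d is c.
record Suffix {A : Set} (c : A) (k : List A) (d : A) (l : List A) : Set where
  constructor suffix
  field
    front : List A
    split : c ∷ k ≡ front ++ d ∷ l

  ⊆all : ∀ {v} → v ∈ d ∷ l → v ∈ c ∷ k
  ⊆all m = subst (_ ∈_) (≡-sym split) (∈-++⁺ʳ front m)

suffix-⊆ : ∀ {A : Set} {c d : A} {k l} → Suffix c k d l → ∀ {v} → v ∈ l → v ∈ k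
suffix-⊆ (suffix [] refl) m = m
suffix-⊆ (suffix (_ ∷ f) refl) m = ∈-++⁺ʳ f (there m)

suffix-unique : ∀ {A : Set} {c d : A} {k l} → Suffix c k d l → Unique k → Unique l
suffix-unique (suffix [] refl) u = u
suffix-unique (suffix (_ ∷ f) refl) u with unique-++⁻ f u
... | _ , (_ ∷ u′) , _ = u′

suffix-length : ∀ {A : Set} {c d : A} {k l} → Suffix c k d l → length l ≤ length k
suffix-length (suffix [] refl) = ≤-refl
suffix-length {l = l} (suffix (_ ∷ f) refl) = ≤-trans (n≤1+n (length l))
  (≤-trans (m≤n+m (suc (length l)) (length f)) (≤-reflexive (≡-sym (length-++ f))))

module _ {A : Set} {_~_ : A → A → Set} (L : List A) (_∈L? : ∀ v → Dec (v ∈ L)) where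

  -- What a tail becomes when the spine under it has changed: `L` is the new spine, and the tail
  -- restarts at its last vertex there, since it may cross `L` several times.
  record LastHit (c : A) (k : List A) (p : A) : Set where
    field
      {d}    : A
      {l}    : List A
      suf    : Suffix c k d l
      d∈L    : d ∈ L
      beyond : Disjoint l L
      walk   : Walk _~_ d l p

  private
    search : ∀ {c k p} → Walk _~_ c k p → LastHit c k p ⊎ Disjoint (c ∷ k) L
    search {c} nil with c ∈L?
    ... | yes m = inj₁ (record { suf = suffix [] refl ; d∈L = m ; beyond = λ () ; walk = nil })
    ... | no n = inj₂ λ { (here refl , m) → n m }
    search {c} (cons e w) with search w
    ... | inj₁ record { suf = suffix f eq ; d∈L = m ; beyond = dis ; walk = w′ } =
      inj₁ (record { suf = suffix (c ∷ f) (cong (c ∷_) eq) ; d∈L = m ; beyond = dis ; walk = w′ })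
    ... | inj₂ dis with c ∈L?
    ...   | yes m = inj₁ (record { suf = suffix [] refl ; d∈L = m ; beyond = dis ; walk = cons e w })
    ...   | no n = inj₂ λ { (here refl , m) → n m ; (there q , m) → dis (q , m) }

  last-hit : ∀ {c k p} → Walk _~_ c k p → c ∈ L → LastHit c k p
  last-hit w m with search w
  ... | inj₁ h = h
  ... | inj₂ d = ⊥-elim (d (here refl , m))

-- Rerouting a walk along a detour

module _ {A : Set} {_~_ : A → A → Set} where

  -- x hangs on the new route by a piece k of R that the route leaves out; the length bound pays
  -- for prolonging the tail at x by k.
  record Reach (s : A) (R route : List A) (u : A) (m : List A) (x : A) : Set where
    field
      {h}    : A
      {k}    : List A
      h≡     : h ≡ x ⊎ h ≡ u
      h∈     : h ∈ s ∷ route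
      walk   : Walk _~_ h k x
      uniq   : Unique k
      ⊆R     : ∀ {y} → y ∈ k → y ∈ s ∷ R
      off    : Disjoint k (s ∷ route)
      bound  : length route + length k ≤ length R + length m

  -- The piece of the walk between u and v gives way to the detour from u through m to v. In use, u
  -- is the foot a′, v is the foot a, and m follows the tail from a′ to c.
  record Rerouted (s t : A) (R : List A) (u v : A) (m : List A) : Set where
    field
      route : List A
      walk  : Walk _~_ s route t
      uniq  : Unique (s ∷ route)
      ⊆old  : ∀ {x} → x ∈ s ∷ route → x ∈ s ∷ R ⊎ x ∈ m
      m⊆    : ∀ {x} → x ∈ m → x ∈ s ∷ route
      v∈    : v ∈ s ∷ route
      reach : ∀ {x} → x ∈ s ∷ R → Reach s R route u m x

  private
    ∈-length : ∀ {x : A} {xs} → x ∈ xs → ∃[ c ] length xs ≡ suc c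
    ∈-length {xs = _ ∷ xs} _ = length xs , refl

  -- Here u precedes v on the old walk. The vertices of `seg` before v are left out, and each of
  -- them is still reached from u along `seg`; every other vertex stays on the route.
  reroute-forward : ∀ {s t u v m} ys seg zs →
    Walk _~_ s ys u → Walk _~_ u seg v → Walk _~_ v zs t → v ∈ seg →
    Unique (s ∷ ys ++ seg ++ zs) →
    Walk _~_ u (m ++ [ v ]) v → Unique m → Disjoint m (s ∷ ys ++ seg ++ zs) →
    Rerouted s t (ys ++ seg ++ zs) u v m
  reroute-forward {s} {t} {u} {v} {m} ys seg zs wys wseg wzs′ v∈seg unqR wm um m#R = record
    { route = route
    ; walk = walk-++ wys (walk-++ wm wzs′)
    ; uniq = unique-++⁺ uys (unique-++⁺ (unique-++⁺ um (unique-∷ (λ ()) []) m#v) uzs mv#zs) ys#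
    ; ⊆old = old
    ; m⊆ = λ q → ∈-++⁺ʳ (s ∷ ys) (∈-++⁺ˡ (∈-++⁺ˡ q))
    ; v∈ = ∈-++⁺ʳ (s ∷ ys) (∈-++⁺ˡ (∈-++⁺ʳ m (here refl)))
    ; reach = reach }
    where
    route = ys ++ (m ++ [ v ]) ++ zs
    parts = unique-++⁻ (s ∷ ys) unqR
    uys = proj₁ parts
    ys#rest = proj₂ (proj₂ parts)
    parts′ = unique-++⁻ seg (proj₁ (proj₂ parts))
    useg = proj₁ parts′
    uzs = proj₁ (proj₂ parts′)
    seg#zs = proj₂ (proj₂ parts′)
    m#v : Disjoint m [ v ]
    m#v (q , here refl) = m#R (q , ∈-++⁺ʳ (s ∷ ys) (∈-++⁺ˡ v∈seg))
    mv#zs : Disjoint (m ++ [ v ]) zs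
    mv#zs (q , r) with ∈-++⁻ m q
    ... | inj₁ q′ = m#R (q′ , ∈-++⁺ʳ (s ∷ ys) (∈-++⁺ʳ seg r))
    ... | inj₂ (here refl) = seg#zs (v∈seg , r)
    ys# : Disjoint (s ∷ ys) ((m ++ [ v ]) ++ zs)
    ys# (q , r) with ∈-++⁻ (m ++ [ v ]) r
    ... | inj₂ r′ = ys#rest (q , ∈-++⁺ʳ seg r′)
    ... | inj₁ r′ with ∈-++⁻ m r′
    ...   | inj₁ r″ = m#R (r″ , ∈-++⁺ˡ q)
    ...   | inj₂ (here refl) = ys#rest (q , ∈-++⁺ˡ v∈seg)
    old : ∀ {x} → x ∈ s ∷ route → x ∈ s ∷ ys ++ seg ++ zs ⊎ x ∈ m
    old q with ∈-++⁻ (s ∷ ys) q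
    ... | inj₁ q′ = inj₁ (∈-++⁺ˡ q′)
    ... | inj₂ q′ with ∈-++⁻ (m ++ [ v ]) q′
    ...   | inj₂ r = inj₁ (∈-++⁺ʳ (s ∷ ys) (∈-++⁺ʳ seg r))
    ...   | inj₁ r with ∈-++⁻ m r
    ...     | inj₁ r′ = inj₂ r′
    ...     | inj₂ (here refl) = inj₁ (∈-++⁺ʳ (s ∷ ys) (∈-++⁺ˡ v∈seg))
    len-route : length route ≡ length ys + ((length m + 1) + length zs)
    len-route = trans (length-++ ys) (cong (length ys +_)
      (trans (length-++ (m ++ [ v ])) (cong (_+ length zs) (length-++ m))))
    rearrange : ∀ y m z k c → (y + ((m + 1) + z)) + k + c ≡ (y + ((k + suc c) + z)) + m
    rearrange = solve-∀
    -- Besides `k`, `seg` has at least one more entry; it pays for the v that closes the detour, and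
    -- the surplus c is given away.
    bound : ∀ k c → length seg ≡ k + suc c →
            length route + k ≤ length (ys ++ seg ++ zs) + length m
    bound k c eq rewrite len-route | length-++ ys {seg ++ zs} | length-++ seg {zs} | eq =
      ≤-trans (m≤m+n _ c) (≤-reflexive (rearrange (length ys) (length m) (length zs) k c))
    stay : ∀ {x} → x ∈ s ∷ route → Reach s (ys ++ seg ++ zs) route u m x
    stay q = record { h≡ = inj₁ refl ; h∈ = q ; walk = nil ; uniq = [] ; ⊆R = λ () ; off = λ ()
                    ; bound = bound 0 _ (proj₂ (∈-length v∈seg)) }
    reach : ∀ {x} → x ∈ s ∷ ys ++ seg ++ zs → Reach s (ys ++ seg ++ zs) route u m x
    reach {x} q with ∈-++⁻ (s ∷ ys) q
    ... | inj₁ q′ = stay (∈-++⁺ˡ q′)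
    ... | inj₂ q′ with ∈-++⁻ seg q′
    ...   | inj₂ r = stay (∈-++⁺ʳ (s ∷ ys) (∈-++⁺ʳ (m ++ [ v ]) r))
    -- `seg` is cut at x. If nothing follows, x is v and stays on the route; otherwise x is left out
    -- and `k` leads to it from u.
    ...   | inj₁ r with walk-at (there r) wseg
    ...     | k , [] , eq , wk , nil = stay (∈-++⁺ʳ (s ∷ ys) (∈-++⁺ˡ (∈-++⁺ʳ m (here refl))))
    ...     | k , k₂@(_ ∷ k₃) , eq , wk , cons _ wk₂ =
              record { h≡ = inj₂ refl ; h∈ = ∈-++⁺ˡ (walk-last wys) ; walk = wk ; uniq = proj₁ uk
                     ; ⊆R = λ p → ∈-++⁺ʳ (s ∷ ys) (∈-++⁺ˡ (k⊆seg p)) ; off = k#route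
                     ; bound = bound (length k) (length k₃) (trans (cong length eq) (length-++ k)) }
      where
      uk = unique-++⁻ k (subst Unique eq useg)
      k⊆seg : ∀ {y} → y ∈ k → y ∈ seg
      k⊆seg p = subst (_ ∈_) (≡-sym eq) (∈-++⁺ˡ p)
      k#route : Disjoint k (s ∷ route)
      k#route (p , p′) with ∈-++⁻ (s ∷ ys) p′
      ... | inj₁ o = ys#rest (o , ∈-++⁺ˡ (k⊆seg p))
      ... | inj₂ o with ∈-++⁻ (m ++ [ v ]) o
      ...   | inj₂ o′ = seg#zs (k⊆seg p , o′)
      ...   | inj₁ o′ with ∈-++⁻ m o′
      ...     | inj₁ o″ = m#R (o″ , ∈-++⁺ʳ (s ∷ ys) (∈-++⁺ˡ (k⊆seg p)))
      ...     | inj₂ (here refl) = proj₂ (proj₂ uk) (p , walk-last wk₂)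

  private
    reroute-after : ∀ {s t u v m ys zs} →
      Walk _~_ s ys u → Walk _~_ u zs t → v ∈ zs → Unique (s ∷ ys ++ zs) →
      Walk _~_ u (m ++ [ v ]) v → Unique m → Disjoint m (s ∷ ys ++ zs) →
      Rerouted s t (ys ++ zs) u v m
    reroute-after {s} {t} {u} {v} {m} {ys} w₁ w₂ v∈zs unqR wm um m#R with ∈-∃++ v∈zs
    ... | seg , zs₂ , refl with walk-split seg w₂
    ...   | w₃ , w₄ = subst (λ xs → Rerouted s t (ys ++ xs) u v m) eq
      (reroute-forward ys (seg ++ [ v ]) zs₂ w₁ w₃ w₄ (∈-++⁺ʳ seg (here refl))
        (subst (λ xs → Unique (s ∷ ys ++ xs)) (≡-sym eq) unqR) wm um
        (subst (λ xs → Disjoint m (s ∷ ys ++ xs)) (≡-sym eq) m#R))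
      where eq = ++-assoc seg [ v ] zs₂

  -- When v precedes u, the walk is reversed, rerouted and reversed back. In both orders the
  -- vertices left out are reached from u and not from v.
  reroute : (∀ {u v} → u ~ v → v ~ u) → ∀ {s t u v m R} →
    Walk _~_ s R t → Unique (s ∷ R) → u ∈ s ∷ R → v ∈ s ∷ R → u ≢ v →
    Walk _~_ u (m ++ [ v ]) v → Unique m → Disjoint m (s ∷ R) →
    Rerouted s t R u v m
  reroute sy {s} {t} {u} {v} {m} {R} w unqR u∈ v∈ u≢v wm um m#R with walk-at u∈ w
  ... | ys , zs , refl , w₁ , w₂ with ∈-++⁻ (s ∷ ys) v∈
  ...   | inj₂ v∈zs = reroute-after w₁ w₂ v∈zs unqR wm um m#R
  ...   | inj₁ v∈ys with walk-reverse sy w₁ | walk-reverse sy w₂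
  ...     | ys′ , eq₁ , w₁′ | zs′ , eq₂ , w₂′ = record
    { route = back
    ; walk = back-walk
    ; uniq = subst Unique (≡-sym back-eq) (unique-reverse F.uniq)
    ; ⊆old = λ q → old (F.⊆old (from q))
    ; m⊆ = λ q → to (F.m⊆ q)
    ; v∈ = to F.v∈
    ; reach = λ q → let open Reach (F.reach (there′ q)) in record
        { h≡ = h≡ ; h∈ = to h∈ ; walk = walk ; uniq = uniq
        ; ⊆R = λ p → back′ (⊆R p) ; off = λ (p , q) → off (p , from q)
        ; bound = subst (λ n → n + length k ≤ length (ys ++ zs) + length m) (≡-sym len-back)
            (subst (λ n → length F.route + length k ≤ n + length m) len-R bound) } }
    where
    R′ = zs′ ++ ys′
    rev-eq : t ∷ R′ ≡ reverse (s ∷ ys ++ zs)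
    rev-eq = begin
      (t ∷ zs′) ++ ys′                ≡⟨ cong (_++ ys′) (trans eq₂ (unfold-reverse u zs)) ⟩
      (reverse zs ++ [ u ]) ++ ys′    ≡⟨ ++-assoc (reverse zs) [ u ] ys′ ⟩
      reverse zs ++ u ∷ ys′           ≡⟨ cong (reverse zs ++_) eq₁ ⟩
      reverse zs ++ reverse (s ∷ ys)  ≡⟨ reverse-++ (s ∷ ys) zs ⟨
      reverse (s ∷ ys ++ zs)          ∎
    v∈ys′ : v ∈ ys′
    v∈ys′ with subst (v ∈_) (≡-sym eq₁) (reverse⁺ v∈ys)
    ... | here eq = ⊥-elim (u≢v (≡-sym eq))
    ... | there q = q
    there′ : ∀ {x} → x ∈ s ∷ ys ++ zs → x ∈ t ∷ R′
    there′ q = subst (_ ∈_) (≡-sym rev-eq) (reverse⁺ q)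
    back′ : ∀ {x} → x ∈ t ∷ R′ → x ∈ s ∷ ys ++ zs
    back′ q = reverse⁻ (subst (_ ∈_) rev-eq q)
    F : Rerouted t s R′ u v m
    F = reroute-after w₂′ w₁′ v∈ys′ (subst Unique (≡-sym rev-eq) (unique-reverse unqR))
          wm um (λ (p , q) → m#R (p , back′ q))
    module F = Rerouted F
    rw = walk-reverse sy F.walk
    back = proj₁ rw
    back-eq = proj₁ (proj₂ rw)
    back-walk = proj₂ (proj₂ rw)
    to : ∀ {x} → x ∈ t ∷ F.route → x ∈ s ∷ back
    to q = subst (_ ∈_) (≡-sym back-eq) (reverse⁺ q)
    from : ∀ {x} → x ∈ s ∷ back → x ∈ t ∷ F.route
    from q = reverse⁻ (subst (_ ∈_) back-eq q)
    old : ∀ {x} → x ∈ t ∷ R′ ⊎ x ∈ m → x ∈ s ∷ ys ++ zs ⊎ x ∈ m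
    old (inj₁ q) = inj₁ (back′ q)
    old (inj₂ q) = inj₂ q
    suc-inj : ∀ {x y} → suc x ≡ suc y → x ≡ y
    suc-inj refl = refl
    len-back : length back ≡ length F.route
    len-back = suc-inj (trans (cong length back-eq) (length-reverse (t ∷ F.route)))
    len-R : length R′ ≡ length (ys ++ zs)
    len-R = suc-inj (trans (cong length rev-eq) (length-reverse (s ∷ ys ++ zs)))

-- Contractions of a graph as maps on its vertices

module Contraction (G : Graph) where

  private
    A = V G

  open import Data.List.Membership.DecPropositional (_≟_ {n G}) using (_∈?_)

  E-sym : ∀ {u v} → E G u v → E G v u
  E-sym {u} {v} = subst T (Graph.sym G u v)

  -- A map f : V G → V G contracts G onto the vertices in its image; Adj f is
  -- adjacency in the contracted graph.
  record Adj (f : A → A) (u v : A) : Set where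
    constructor adjacent
    field
      {a b} : A
      fa≡u  : f a ≡ u
      fb≡v  : f b ≡ v
      edge  : E G a b
      u≢v   : u ≢ v

  adj-sym : ∀ {f u v} → Adj f u v → Adj f v u
  adj-sym (adjacent p q e ne) = adjacent q p (E-sym e) (λ eq → ne (≡-sym eq))

  adj-∘ : ∀ {f} g {u v} → Adj f u v → g u ≢ g v → Adj (g ∘ f) (g u) (g v)
  adj-∘ g (adjacent p q e _) ne = adjacent (cong g p) (cong g q) e ne

  adj-∘-fixed : ∀ {f} g {u v} → g u ≡ u → g v ≡ v → Adj f u v → Adj (g ∘ f) u v
  adj-∘-fixed g p q (adjacent pa pb e ne) =
    adjacent (trans (cong g pa) p) (trans (cong g pb) q) e ne

  walk-∘-fixed : ∀ {f} g {s xs t} → (∀ {v} → v ∈ s ∷ xs → g v ≡ v) →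
                 Walk (Adj f) s xs t → Walk (Adj (g ∘ f)) s xs t
  walk-∘-fixed g fix = walk-⇒ λ p q → adj-∘-fixed g (fix p) (fix q)

  -- Idempotence puts every vertex of the image into its own fibre, so vertices of G serve as names
  -- for those of the contracted graph. The fibres become the branch sets of the minor.
  record Contracts (f : A → A) : Set where
    field
      idem      : ∀ v → f (f v) ≡ f v
      connected : ∀ u a b → f a ≡ u → f b ≡ u → WalkIn G (λ c → f c ≡ u) a b

  walkIn-++ : ∀ {S : A → Set} {a b c} → WalkIn G S a b → WalkIn G S b c → WalkIn G S a c
  walkIn-++ (stop _) w = w
  walkIn-++ (step s e v) w = step s e (walkIn-++ v w)

  walkIn-⇒ : ∀ {S S′ : A → Set} {a b} → (∀ {c} → S c → S′ c) → WalkIn G S a b → WalkIn G S′ a b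
  walkIn-⇒ k (stop s) = stop (k s)
  walkIn-⇒ k (step s e w) = step (k s) e (walkIn-⇒ k w)

  merge : A → A → A → A
  merge b a v with v ≟ b
  ... | yes _ = a
  ... | no _ = v

  merge-self : ∀ b a → merge b a b ≡ a
  merge-self b a with b ≟ b
  ... | yes _ = refl
  ... | no n = ⊥-elim (n refl)

  merge-≢ : ∀ {b a v} → v ≢ b → merge b a v ≡ v
  merge-≢ {b} {a} {v} n with v ≟ b
  ... | yes p = ⊥-elim (n p)
  ... | no _ = refl

  -- The only new nonempty fibre is the union of those of a and b. A walk that must change sides
  -- passes through the edge of G behind `Adj f b a`.
  merge-contracts : ∀ {f b a} → Contracts f → Adj f b a → Contracts (merge b a ∘ f)
  merge-contracts {f} {b} {a} C (adjacent {b₀} {a₀} fb₀ fa₀ e b≢a) = record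
    { idem = idem′ ; connected = connected′ }
    where
    open Contracts C
    μ = merge b a
    a≢b : a ≢ b
    a≢b p = b≢a (≡-sym p)
    fa : f a ≡ a
    fa = trans (cong f (≡-sym fa₀)) (trans (idem a₀) fa₀)
    idem′ : ∀ v → μ (f (μ (f v))) ≡ μ (f v)
    idem′ v with f v ≟ b
    ... | yes p = trans (cong μ fa) (merge-≢ a≢b)
    ... | no n = trans (cong μ (idem v)) (merge-≢ n)
    weaken : ∀ {u c d x} → f c ≡ x → f d ≡ x → μ x ≡ u → WalkIn G (λ z → μ (f z) ≡ u) c d
    weaken p q r = walkIn-⇒ (λ s → trans (cong μ s) r) (connected _ _ _ p q)
    μb : μ b ≡ a
    μb = merge-self b a
    μa : μ a ≡ a
    μa = merge-≢ a≢b
    connected′ : ∀ u c d → μ (f c) ≡ u → μ (f d) ≡ u → WalkIn G (λ z → μ (f z) ≡ u) c d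
    connected′ u c d p q with f c ≟ b | f d ≟ b
    ... | yes fc | yes fd = weaken fc fd (trans μb p)
    ... | no nc | no nd = weaken refl (trans q (≡-sym p)) (trans (merge-≢ nc) p)
    ... | yes fc | no nd = walkIn-++ (weaken fc fb₀ (trans μb p))
      (step (trans (cong μ fb₀) (trans μb p)) e (weaken fa₀ (trans q (≡-sym p)) (trans μa p)))
    ... | no nc | yes fd = walkIn-++ (weaken (trans p (≡-sym q)) fa₀ (trans μa q))
      (step (trans (cong μ fa₀) (trans μa q)) (E-sym e) (weaken fb₀ fd (trans μb q)))

  -- The tail of an ear: the walk from a on the path with vertices R to the vertex p,
  -- leaving R for good after a.
  record Tail (f : A → A) (R : List A) (a : A) (l : List A) (p : A) : Set where
    field
      foot : a ∈ R
      off  : Disjoint l R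
      uniq : Unique l
      walk : Walk (Adj f) a l p

  -- Only b moves, and it is not on the tail. The end is still written `merge b a p` because the
  -- ends of all tails are tracked as images under the contractions.
  merge-tail : ∀ {f R b a x l p} → b ∉ R → b ∉ l → Tail f R x l p →
               Tail (merge b a ∘ f) R x l (merge b a p)
  merge-tail {b = b} {a} {x} {l} {p} b∉R b∉l T = record
    { foot = foot ; off = off ; uniq = uniq
    ; walk = subst (Walk _ x l) (≡-sym (fix (walk-last walk))) (walk-∘-fixed (merge b a) fix walk) }
    where
    open Tail T
    fix : ∀ {v} → v ∈ x ∷ l → merge b a v ≡ v
    fix (here refl) = merge-≢ λ { refl → b∉R foot }
    fix (there m) = merge-≢ λ { refl → b∉l m }

  -- The merged vertex replaces b at the head of the walk. If `l` is empty, then p is b, and the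
  -- contraction carries it onto the spine.
  merge-head : ∀ {f R b a l p} → b ∉ R → a ∈ R → Unique (b ∷ l) → Disjoint l R →
               Walk (Adj f) b l p → Tail (merge b a ∘ f) R a l (merge b a p)
  merge-head {f} {R} {b} {a} {l} {p} b∉R a∈R u@(_ ∷ u′) l#R w = record
    { foot = a∈R ; off = l#R ; uniq = u′ ; walk = go w l#R (Unique[x∷xs]⇒x∉xs u) }
    where
    μ = merge b a
    go : ∀ {l} → Walk (Adj f) b l p → Disjoint l R → b ∉ l → Walk (Adj (μ ∘ f)) a l (μ p)
    go nil _ _ rewrite merge-self b a = nil
    go (cons {b = c} {xs = xs} e w) l#R b∉l =
      cons (subst (λ x → Adj (μ ∘ f) x c) (merge-self b a)
             (subst (Adj (μ ∘ f) (μ b)) μc (adj-∘ μ e ne)))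
           (subst (Walk _ c xs) (≡-sym (fix (walk-last w))) (walk-∘-fixed μ fix w))
      where
      fix : ∀ {v} → v ∈ c ∷ xs → μ v ≡ v
      fix m = merge-≢ λ { refl → b∉l m }
      μc : μ c ≡ c
      μc = fix (here refl)
      -- b has become a, which lies on R, whereas c is off R.
      ne : μ b ≢ μ c
      ne eq = l#R (here refl , subst (_∈ R) (trans (≡-sym (merge-self b a)) (trans eq μc)) a∈R)

  -- The moves at one vertex of the tree

  -- The situation at a vertex y: s and t are the ends of `P y`, e is the end that no child's ear
  -- contains, and S is the region available to the moves at y.
  module Ears (s t : A) (S : A → Set) (e : A) (e-end : e ≡ s ⊎ e ≡ t) where

    record Spine (f : A → A) (R : List A) : Set where
      field
        walk : Walk (Adj f) s R t
        uniq : Unique (s ∷ R)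
        ⊆S   : ∀ {v} → v ∈ s ∷ R → S v

      e∈ : e ∈ s ∷ R
      e∈ = [ (λ eq → here eq) , (λ eq → subst (_∈ s ∷ R) (≡-sym eq) (walk-last walk)) ]′ e-end

    -- One ear over the spine without its middle path: p and q are the ends of `P x`, and a and b
    -- are the feet of the tails leading to them.
    record Tails (f : A → A) (R : List A) (a : A) (l : List A) (p : A)
                 (b : A) (r : List A) (q : A) : Set where
      field
        left  : Tail f (s ∷ R) a l p
        right : Tail f (s ∷ R) b r q
        disj  : Disjoint (a ∷ l) (b ∷ r)
        e≢a   : e ≢ a
        e≢b   : e ≢ b
        l⊆S   : ∀ {v} → v ∈ l → S v
        r⊆S   : ∀ {v} → v ∈ r → S v

    swap : ∀ {f R a l p b r q} → Tails f R a l p b r q → Tails f R b r q a l p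
    swap T = record { left = right ; right = left ; disj = λ (x , y) → disj (y , x)
                    ; e≢a = e≢b ; e≢b = e≢a ; l⊆S = r⊆S ; r⊆S = l⊆S }
      where open Tails T

    -- The goal for one ear: its ends have been contracted onto two different vertices of the spine,
    -- both different from e, so that cleanness survives.
    record Feet (g : A → A) (R : List A) (p q : A) : Set where
      constructor feet
      field
        p∈  : g p ∈ s ∷ R
        q∈  : g q ∈ s ∷ R
        p≢q : g p ≢ g q
        e≢p : e ≢ g p
        e≢q : e ≢ g q

    feet-swap : ∀ {g R p q} → Feet g R p q → Feet g R q p
    feet-swap (feet a b c d e) = feet b a (λ eq → c (≡-sym eq)) e d

    -- `fixed` also covers s and t, even if they lie in S: they are shared with the paths above y,
    -- and only the contractions made there may move them.
    record Attached (f : A → A) (p q p′ q′ : A) : Set where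
      field
        {g}       : A → A
        {R}       : List A
        contracts : Contracts (g ∘ f)
        spine     : Spine (g ∘ f) R
        fixed     : ∀ {v} → ¬ (S v × v ≢ s × v ≢ t) → g v ≡ v
        feet₁     : Feet g R p q
        feet₂     : Feet g R p′ q′

    attached-swap : ∀ {f p q p′ q′} → Attached f p q p′ q′ → Attached f p′ q′ p q
    attached-swap X = record { contracts = contracts ; spine = spine ; fixed = fixed
                             ; feet₁ = feet₂ ; feet₂ = feet₁ }
      where open Attached X

    attached-swap₁ : ∀ {f p q p′ q′} → Attached f p q p′ q′ → Attached f q p p′ q′
    attached-swap₁ X = record { contracts = contracts ; spine = spine ; fixed = fixed
                              ; feet₁ = feet-swap feet₁ ; feet₂ = feet₂ }
      where open Attached X

    attached-swap₂ : ∀ {f p q p′ q′} → Attached f p q p′ q′ → Attached f p q q′ p′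
    attached-swap₂ X = attached-swap (attached-swap₁ (attached-swap X))

    size : (R l r l′ r′ : List A) → ℕ
    size R l r l′ r′ = length R + ((length l + length r) + (length l′ + length r′))

    -- The induction hypothesis for the measure `size`. The reduction steps take it as an argument,
    -- so that only `solve` recurs.
    Solver : ℕ → Set
    Solver n = ∀ {f R a l p b r q a′ l′ p′ b′ r′ q′} → size R l r l′ r′ < n →
      Contracts f → Spine f R → Tails f R a l p b r q → Tails f R a′ l′ p′ b′ r′ q′ →
      Attached f p q p′ q′

    -- The contraction of the edge a c into a, common to `contract-free` and `contract-hit`. These
    -- differ only in what becomes of the second ear, whose new tails are therefore supplied by the
    -- caller.
    contract-first : ∀ {n f R a c l p b r q a₁ l₁ b₁ r₁ p′ q′} → Solver n →
      size R l r l₁ r₁ < n → c ∉ r →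
      Contracts f → Spine f R → Tails f R a (c ∷ l) p b r q →
      Tails (merge c a ∘ f) R a₁ l₁ (merge c a p′) b₁ r₁ (merge c a q′) →
      Attached f p q p′ q′
    contract-first {f = f} {R} {a} {c} {l} {p} {b} {r} {q} {p′ = p′} {q′} rec small c∉r C Sp T T′
      with Tails.left T | Tails.right T
    ... | record { foot = a∈ ; off = off ; uniq = u ; walk = cons ac w } | right
      = result (rec small (merge-contracts C (adj-sym ac))
          (record { walk = walk-∘-fixed μ (λ m → merge-≢ λ { refl → c∉R m }) walk
                  ; uniq = uniq ; ⊆S = ⊆S })
          (record { left = merge-head c∉R a∈ u (λ (m , m′) → off (there m , m′)) w
                  ; right = merge-tail c∉R c∉r right
                  ; disj = λ { (here refl , m) → disj (here refl , m)
                             ; (there m , m′) → disj (there (there m) , m′) }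
                  ; e≢a = e≢a ; e≢b = e≢b
                  ; l⊆S = λ m → l⊆S (there m) ; r⊆S = r⊆S })
          T′)
      where
      open Spine Sp
      open Tails T hiding (left; right)
      μ = merge c a
      c∉R : c ∉ s ∷ R
      c∉R m = off (here refl , m)
      result : Attached (μ ∘ f) (μ p) (μ q) (μ p′) (μ q′) → Attached f p q p′ q′
      result X = record
        { g = X.g ∘ μ ; R = X.R ; contracts = X.contracts ; spine = X.spine
        -- `μ` moves only c, which lies in S and off the spine, so it is neither s nor t.
        ; fixed = λ {v} n → trans (cong X.g (merge-≢ λ { refl →
            n (l⊆S (here refl) , (λ { refl → c∉R (here refl) }) ,
               (λ { refl → c∉R (walk-last walk) })) })) (X.fixed n)
        ; feet₁ = let open Feet X.feet₁ in feet p∈ q∈ p≢q e≢p e≢q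
        ; feet₂ = let open Feet X.feet₂ in feet p∈ q∈ p≢q e≢p e≢q }
        where module X = Attached X

    private
      drop-one : ∀ R l r x → suc (R + ((l + r) + x)) ≡ R + ((suc l + r) + x)
      drop-one = solve-∀

    contract-free : ∀ {n f R a c l p b r q a′ l′ p′ b′ r′ q′} → Solver n →
      size R (c ∷ l) r l′ r′ ≤ n → Contracts f → Spine f R →
      Tails f R a (c ∷ l) p b r q → Tails f R a′ l′ p′ b′ r′ q′ →
      c ∉ l′ → c ∉ r′ → Attached f p q p′ q′
    contract-free {n} {R = R} {c = c} {l} {r = r} {l′ = l′} {r′ = r′} rec small C Sp T T′ c∉l′ c∉r′ =
      contract-first rec
        (subst (_≤ n) (≡-sym (drop-one (length R) (length l) (length r) (length l′ + length r′))) small)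
        (λ m → disj (there (here refl) , there m)) C Sp T
        (record { left = merge-tail c∉R c∉l′ left′ ; right = merge-tail c∉R c∉r′ right′
                ; disj = disj′ ; e≢a = e≢a′ ; e≢b = e≢b′ ; l⊆S = l′⊆S ; r⊆S = r′⊆S })
      where
      open Tails T
      open Tails T′ renaming (left to left′; right to right′; disj to disj′; e≢a to e≢a′;
                              e≢b to e≢b′; l⊆S to l′⊆S; r⊆S to r′⊆S)
      c∉R : c ∉ s ∷ R
      c∉R m = Tail.off left (here refl , m)

    -- The left tail of the second ear restarts at the merged vertex a and gives up `l₁` and c;
    -- `a ≢ b′` keeps the feet of this ear distinct.
    contract-hit : ∀ {n f R a c l p b r q a′ p′ b′ r′ q′} l₁ l₂ → Solver n →
      size R (c ∷ l) r (l₁ ++ c ∷ l₂) r′ ≤ n → Contracts f → Spine f R →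
      Tails f R a (c ∷ l) p b r q → Tails f R a′ (l₁ ++ c ∷ l₂) p′ b′ r′ q′ →
      a ≢ b′ → Attached f p q p′ q′
    contract-hit {n} {R = R} {a} {c} {l} {r = r} {a′ = a′} {b′ = b′} {r′} l₁ l₂ rec small C Sp T T′ a≢b′ =
      contract-first rec small′ (λ m → disj (there (here refl) , there m)) C Sp T
        (record { left = merge-head c∉R (Tail.foot left) (proj₁ (proj₂ parts))
                           (λ (m , m′) → Tail.off left′ (l₂⊆ (there m) , m′))
                           (proj₂ (walk-split l₁ (Tail.walk left′)))
                ; right = merge-tail c∉R (λ m → disj′ (there (l₂⊆ (here refl)) , there m)) right′
                ; disj = λ { (here refl , here eq) → a≢b′ eq
                           ; (here refl , there m) → Tail.off right′ (m , Tail.foot left)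
                           ; (there m , m′) → disj′ (there (l₂⊆ (there m)) , m′) }
                ; e≢a = e≢a ; e≢b = e≢b′ ; l⊆S = λ m → l′⊆S (l₂⊆ (there m)) ; r⊆S = r′⊆S })
      where
      open Tails T
      open Tails T′ renaming (left to left′; right to right′; disj to disj′; e≢a to e≢a′;
                              e≢b to e≢b′; l⊆S to l′⊆S; r⊆S to r′⊆S)
      c∉R : c ∉ s ∷ R
      c∉R m = Tail.off left (here refl , m)
      parts = unique-++⁻ l₁ (Tail.uniq left′)
      l₂⊆ : ∀ {v} → v ∈ c ∷ l₂ → v ∈ l₁ ++ c ∷ l₂
      l₂⊆ = ∈-++⁺ʳ l₁
      arith : ∀ R l r x y z → suc (R + ((l + r) + (y + z))) + x ≡ R + ((l + r) + ((x + suc y) + z))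
      arith = solve-∀
      -- The loss of c from the tail of the second ear already makes the measure drop.
      small′ : size R l r l₂ r′ < n
      small′ = ≤-trans (s≤s (+-monoʳ-≤ (length R) (+-monoˡ-≤ _ (+-monoˡ-≤ (length r) (n≤1+n (length l))))))
        (≤-trans (m≤m+n _ (length l₁)) (≤-trans (≤-reflexive
          (trans (arith (length R) (suc (length l)) (length r) (length l₁) (length l₂) (length r′))
            (cong (λ x → length R + ((suc (length l) + length r) + (x + length r′)))
              (≡-sym (length-++ l₁))))) small))

    -- The left tail of the first ear starts with the edge a c, and c lies on the left tail of
    -- the second ear, whose right tail starts at a. Contracting a c would join the two tails of
    -- the second ear, so the spine is led from a′ along that tail to c and then to a.
    reroute-hit : ∀ {n f R a c l p b r q a′ p′ r′ q′} l₁ l₂ → Solver n →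
      size R (c ∷ l) r (l₁ ++ c ∷ l₂) r′ ≤ n → Contracts f → Spine f R →
      Tails f R a (c ∷ l) p b r q → Tails f R a′ (l₁ ++ c ∷ l₂) p′ a r′ q′ →
      Attached f p q p′ q′
    reroute-hit {n} {f} {R} {a} {c} {l} {p} {b} {r} {q} {a′} {p′} {r′} {q′} l₁ l₂ rec small C Sp T T′
      with Tails.left T | walk-split l₁ (Tail.walk (Tails.left T′))
    ... | left@record { foot = a∈ ; off = off ; uniq = u ; walk = cons ac w } | w₁ , w₂ =
      rec small′ C newSpine
        (record { left = record { foot = Z₀.d∈L ; off = Z₀.beyond
                                ; uniq = suffix-unique Z₀.suf (unique-tail u) ; walk = Z₀.walk }
                ; right = record { foot = Z₁.d∈L ; off = Z₁.beyond
                                 ; uniq = suffix-unique Z₁.suf (unique-++⁺ uk (Tail.uniq right)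
                                     λ (m , m′) → Tail.off right (m′ , k⊆ m))
                                 ; walk = Z₁.walk }
                ; disj = λ (m , m′) → apart (Suffix.⊆all Z₀.suf m) (Suffix.⊆all Z₁.suf m′)
                ; e≢a = λ e≡d → off (Suffix.⊆all Z₀.suf (here e≡d) , e∈)
                ; e≢b = λ e≡d → e-off (Suffix.⊆all Z₁.suf (here e≡d))
                ; l⊆S = λ m → l⊆S (there (suffix-⊆ Z₀.suf m))
                ; r⊆S = λ m → [ (λ m → ⊆S (k⊆ m)) , r⊆S ]′ (∈-++⁻ k (suffix-⊆ Z₁.suf m)) })
        (record { left = record { foot = X.m⊆ (∈-++⁺ʳ l₁ (here refl)) ; off = l₂#
                                ; uniq = unique-tail uc ; walk = w₂ }
                ; right = record { foot = X.v∈ ; off = r′# ; uniq = Tail.uniq right′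
                                 ; walk = Tail.walk right′ }
                ; disj = λ (m , m′) → disj′ (there (l₂⊆ m) , m′)
                ; e≢a = λ e≡c → off (here e≡c , e∈)
                ; e≢b = e≢b′
                ; l⊆S = λ m → l′⊆S (l₂⊆ (there m)) ; r⊆S = r′⊆S })
      where
      open Spine Sp hiding (walk; uniq)
      open Tails T hiding (left)
      open Tails T′ renaming (left to left′; right to right′; disj to disj′; e≢a to e≢a′;
                              e≢b to e≢b′; l⊆S to l′⊆S; r⊆S to r′⊆S)
      unique-tail : ∀ {x : A} {xs} → Unique (x ∷ xs) → Unique xs
      unique-tail (_ ∷ u) = u
      m = l₁ ++ [ c ]
      l₂⊆ : ∀ {v} → v ∈ c ∷ l₂ → v ∈ l₁ ++ c ∷ l₂
      l₂⊆ = ∈-++⁺ʳ l₁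
      m++ : m ++ l₂ ≡ l₁ ++ c ∷ l₂
      m++ = ++-assoc l₁ [ c ] l₂
      m⊆ : ∀ {v} → v ∈ m → v ∈ l₁ ++ c ∷ l₂
      m⊆ q = subst (_ ∈_) m++ (∈-++⁺ˡ q)
      uc = proj₁ (proj₂ (unique-++⁻ l₁ (Tail.uniq left′)))
      parts = unique-++⁻ m (subst Unique (≡-sym m++) (Tail.uniq left′))
      -- The detour runs from a′ through `l₁` to c and closes with the edge from c to a.
      X : Rerouted s t R a′ a m
      X = reroute adj-sym (Spine.walk Sp) (Spine.uniq Sp) (Tail.foot left′) a∈
            (λ eq → disj′ (here refl , here eq)) (walk-++ w₁ (cons (adj-sym ac) nil))
            (proj₁ parts) (λ (q , q′) → Tail.off left′ (m⊆ q , q′))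
      module X = Rerouted X
      _∈R? : ∀ v → Dec (v ∈ s ∷ X.route)
      v ∈R? = v ∈? (s ∷ X.route)
      -- c is now on the spine, but `l` may meet the new spine again along `l₁`; the tail restarts
      -- at the last such vertex.
      module Z₀ = LastHit (last-hit (s ∷ X.route) _∈R? w (X.m⊆ (∈-++⁺ʳ l₁ (here refl))))
      -- The foot b of the right tail may have been left out of the spine. Then `k` joins it to a′;
      -- otherwise `k` is empty.
      open Reach (X.reach (Tail.foot right)) using (h; k; h≡; h∈; bound)
        renaming (walk to wk; uniq to uk; ⊆R to k⊆; off to k#)
      module Z₁ = LastHit (last-hit (s ∷ X.route) _∈R? (walk-++ wk (Tail.walk right)) h∈)
      newSpine : Spine f X.route
      newSpine = record { walk = X.walk ; uniq = X.uniq
                        ; ⊆S = λ q → [ ⊆S , (λ m → l′⊆S (m⊆ m)) ]′ (X.⊆old q) }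
      l₂# : Disjoint l₂ (s ∷ X.route)
      l₂# (q , q′) with X.⊆old q′
      ... | inj₁ o = Tail.off left′ (l₂⊆ (there q) , o)
      ... | inj₂ o = proj₂ (proj₂ parts) (o , q)
      r′# : Disjoint r′ (s ∷ X.route)
      r′# (q , q′) with X.⊆old q′
      ... | inj₁ o = Tail.off right′ (q , o)
      ... | inj₂ o = disj′ (there (m⊆ o) , there q)
      apart : ∀ {v} → v ∈ c ∷ l → v ∈ h ∷ k ++ r → ⊥
      apart q (here v≡h) =
        [ (λ h≡b → disj (there q , here (trans v≡h h≡b)))
        , (λ h≡a′ → off (q , subst (_∈ s ∷ R) (≡-sym (trans v≡h h≡a′)) (Tail.foot left′))) ]′ h≡
      apart q (there q′) =
        [ (λ o → off (q , k⊆ o)) , (λ o → disj (there q , there o)) ]′ (∈-++⁻ k q′)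
      e-off : e ∉ h ∷ k ++ r
      e-off (here e≡h) = [ (λ h≡b → e≢b (trans e≡h h≡b)) , (λ h≡a′ → e≢a′ (trans e≡h h≡a′)) ]′ h≡
      -- e is an end of the new spine too, and `k` misses that spine.
      e-off (there q) = [ (λ o → k# (o , Spine.e∈ newSpine)) , (λ o → Tail.off right (o , e∈)) ]′ (∈-++⁻ k q)
      len₁ : length Z₁.l ≤ length k + length r
      len₁ = ≤-trans (suffix-length Z₁.suf) (≤-reflexive (length-++ k))
      regroup : ∀ R l k r x → R + ((l + (k + r)) + x) ≡ (R + k) + ((l + r) + x)
      regroup = solve-∀
      arith : ∀ R l r x y z →
              suc ((R + (x + 1)) + ((l + r) + (y + z))) ≡ R + ((suc l + r) + ((x + suc y) + z))
      arith = solve-∀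
      -- By `bound`, the new spine and `k` together cost at most R plus `l₁` and c, which the second
      -- ear gives up. The strict drop comes from c, which the left tail of the first ear loses as
      -- well.
      small′ : size X.route Z₀.l Z₁.l l₂ r′ < n
      small′ = ≤-trans (s≤s (+-monoʳ-≤ (length X.route)
                 (+-monoˡ-≤ (length l₂ + length r′) (+-mono-≤ (suffix-length Z₀.suf) len₁))))
        (≤-trans (≤-reflexive (cong suc (regroup (length X.route) (length l) (length k) (length r) _)))
        (≤-trans (s≤s (+-monoˡ-≤ _ bound))
        (≤-trans (≤-reflexive (trans
          (cong (λ x → suc ((length R + x) + ((length l + length r) + (length l₂ + length r′))))
            (length-++ l₁))
          (trans (arith (length R) (length l) (length r) (length l₁) (length l₂) (length r′))
            (cong (λ x → length R + ((suc (length l) + length r) + (x + length r′)))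
              (≡-sym (length-++ l₁)))))) small)))

    private
      swap-size₁ : ∀ R l r l′ r′ → size R l r l′ r′ ≡ size R r l l′ r′
      swap-size₁ R l r l′ r′ =
        cong (λ x → length R + (x + (length l′ + length r′))) (+-comm (length l) (length r))

      swap-size₂ : ∀ R l r l′ r′ → size R l r l′ r′ ≡ size R l r r′ l′
      swap-size₂ R l r l′ r′ =
        cong (λ x → length R + ((length l + length r) + x)) (+-comm (length l′) (length r′))

      swap-size : ∀ R l r l′ r′ → size R l r l′ r′ ≡ size R l′ r′ l r
      swap-size R l r l′ r′ = cong (length R +_) (+-comm (length l + length r) (length l′ + length r′))

    hit : ∀ {n f R a c l p b r q a′ l′ p′ b′ r′ q′} → Solver n →
      size R (c ∷ l) r l′ r′ ≤ n → Contracts f → Spine f R →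
      Tails f R a (c ∷ l) p b r q → Tails f R a′ l′ p′ b′ r′ q′ →
      c ∈ l′ → Attached f p q p′ q′
    hit {a = a} {b′ = b′} rec small C Sp T T′ c∈l′ with ∈-∃++ c∈l′
    ... | l₁ , l₂ , refl with a ≟ b′
    ...   | yes refl = reroute-hit l₁ l₂ rec small C Sp T T′
    ...   | no a≢b′ = contract-hit l₁ l₂ rec small C Sp T T′ a≢b′

    reduce : ∀ {n f R a c l p b r q a′ l′ p′ b′ r′ q′} → Solver n →
      size R (c ∷ l) r l′ r′ ≤ n → Contracts f → Spine f R →
      Tails f R a (c ∷ l) p b r q → Tails f R a′ l′ p′ b′ r′ q′ →
      Attached f p q p′ q′
    reduce {n} {R = R} {c = c} {l} {r = r} {l′ = l′} {r′ = r′} rec small C Sp T T′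
      with c ∈? l′ | c ∈? r′
    ... | yes m | _ = hit rec small C Sp T T′ m
    ... | no _ | yes m = attached-swap₂
      (hit rec (subst (_≤ n) (swap-size₂ R (c ∷ l) r l′ r′) small) C Sp T (swap T′) m)
    ... | no c∉l′ | no c∉r′ = contract-free rec small C Sp T T′ c∉l′ c∉r′

    -- Symmetry brings a nonempty tail to the front. When all four are empty, the ends of both ears
    -- coincide with their feet.
    solve : ∀ n → Solver n
    solve (suc n) {l = c ∷ l} (s≤s small) C Sp T T′ = reduce (solve n) small C Sp T T′
    solve (suc n) {R = R} {l = []} {r = c ∷ r} {l′ = l′} {r′ = r′} (s≤s small) C Sp T T′ = attached-swap₁
      (reduce (solve n) (subst (_≤ n) (swap-size₁ R [] (c ∷ r) l′ r′) small) C Sp (swap T) T′)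
    solve (suc n) {R = R} {l = []} {r = []} {l′ = c ∷ l′} {r′ = r′} (s≤s small) C Sp T T′ = attached-swap
      (reduce (solve n) (subst (_≤ n) (swap-size R [] [] (c ∷ l′) r′) small) C Sp T′ T)
    solve (suc n) {R = R} {l = []} {r = []} {l′ = []} {r′ = c ∷ r′} (s≤s small) C Sp T T′ =
      attached-swap (attached-swap₁ (reduce (solve n)
        (subst (_≤ n) (trans (swap-size₂ R [] [] [] (c ∷ r′)) (swap-size R [] [] (c ∷ r′) [])) small)
        C Sp (swap T′) T))
    solve (suc n) {l = []} {r = []} {l′ = []} {r′ = []} _ C Sp T T′ = record
      { g = id ; contracts = C ; spine = Sp ; fixed = λ _ → refl
      ; feet₁ = trivial T ; feet₂ = trivial T′ }
      where
      trivial : ∀ {f R a p b q} → Tails f R a [] p b [] q → Feet id R p q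
      trivial record { left = record { foot = a∈ ; walk = nil }
                     ; right = record { foot = b∈ ; walk = nil }
                     ; disj = disj ; e≢a = e≢a ; e≢b = e≢b } =
        feet a∈ b∈ (λ { refl → disj (here refl , here refl) }) e≢a e≢b

    attach : ∀ {f R a l p b r q a′ l′ p′ b′ r′ q′} → Contracts f → Spine f R →
      Tails f R a l p b r q → Tails f R a′ l′ p′ b′ r′ q′ → Attached f p q p′ q′
    attach {R = R} {l = l} {r = r} {l′ = l′} {r′ = r′} = solve (suc (size R l r l′ r′)) ≤-refl

-- Cutting a subpath out of a path

consec-∈ : ∀ {A : Set} {xs : List A} {u v} → Consec xs u v → u ∈ xs × v ∈ xs
consec-∈ here = here refl , there (here refl)
consec-∈ (there c) = let (p , q) = consec-∈ c in there p , there q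

consec-split : ∀ {A : Set} (xs : List A) {c ys u v} → Consec (xs ++ c ∷ ys) u v → u ≢ c → v ≢ c →
               (u ∈ xs × v ∈ xs) ⊎ (u ∈ ys × v ∈ ys)
consec-split [] here u≢ v≢ = ⊥-elim (u≢ refl)
consec-split [] (there k) u≢ v≢ = inj₂ (consec-∈ k)
consec-split (x ∷ []) here u≢ v≢ = ⊥-elim (v≢ refl)
consec-split (x ∷ y ∷ xs) here u≢ v≢ = inj₁ (here refl , there (here refl))
consec-split (x ∷ xs) (there k) u≢ v≢ with consec-split xs k u≢ v≢
... | inj₁ (p , q) = inj₁ (there p , there q)
... | inj₂ r = inj₂ r

-- The property is carried up to the head of the list and from there down to v.
consec-closed : ∀ {A : Set} {K : A → Set} {xs} →
                (∀ u v → Consec xs u v → (K u → K v) × (K v → K u)) →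
                ∀ {w v} → w ∈ xs → K w → v ∈ xs → K v
consec-closed {K = K} {xs = _ ∷ _} transfer w∈ kw v∈ = down transfer v∈ (up transfer w∈ kw)
  where
  up : ∀ {x xs w} → (∀ u v → Consec (x ∷ xs) u v → (K u → K v) × (K v → K u)) →
       w ∈ x ∷ xs → K w → K x
  up transfer (here refl) k = k
  up {xs = y ∷ ys} transfer (there m) k =
    proj₂ (transfer _ _ here) (up (λ u v c → transfer u v (there c)) m k)
  down : ∀ {x xs v} → (∀ u v → Consec (x ∷ xs) u v → (K u → K v) × (K v → K u)) →
         v ∈ x ∷ xs → K x → K v
  down transfer (here refl) k = k
  down {xs = y ∷ ys} transfer (there m) k =
    down (λ u v c → transfer u v (there c)) m (proj₁ (transfer _ _ here) k)

-- `L` moves only along edges of the path and misses c, so it cannot pass from one side of c to the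
-- other. This shows that a subpath, given merely by inclusion of vertices and edges, occupies an
-- interval.
module _ {A : Set} {xs : List A} {c : A} {ys : List A} (unq : Unique (xs ++ c ∷ ys))
         {L : List A} (c∉L : c ∉ L)
         (linked : ∀ u v → Consec L u v → EdgeIn (xs ++ c ∷ ys) u v) where

  private
    c∉ : ∀ {u} → u ∈ L → u ≢ c
    c∉ m refl = c∉L m

    sides : ∀ u v → Consec L u v → (u ∈ xs × v ∈ xs) ⊎ (u ∈ ys × v ∈ ys)
    sides u v k with consec-∈ k | linked u v k
    ... | p , q | inj₁ k′ = consec-split xs k′ (c∉ p) (c∉ q)
    ... | p , q | inj₂ k′ with consec-split xs k′ (c∉ q) (c∉ p)
    ...   | inj₁ (a , b) = inj₁ (b , a)
    ...   | inj₂ (a , b) = inj₂ (b , a)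

    xs#ys : ∀ {v} → v ∈ xs → v ∈ ys → ⊥
    xs#ys p q = proj₂ (proj₂ (unique-++⁻ xs unq)) (p , there q)

  stays-after : ∀ {w v} → w ∈ L → w ∈ ys → v ∈ L → v ∈ ys
  stays-after = consec-closed transfer
    where
    transfer : ∀ u v → Consec L u v → (u ∈ ys → v ∈ ys) × (v ∈ ys → u ∈ ys)
    transfer u v k with sides u v k
    ... | inj₁ (a , b) = (λ a′ → ⊥-elim (xs#ys a a′)) , (λ b′ → ⊥-elim (xs#ys b b′))
    ... | inj₂ (a , b) = (λ _ → b) , (λ _ → a)

  stays-before : ∀ {w v} → w ∈ L → w ∈ xs → v ∈ L → v ∈ xs
  stays-before = consec-closed transfer
    where
    transfer : ∀ u v → Consec L u v → (u ∈ xs → v ∈ xs) × (v ∈ xs → u ∈ xs)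
    transfer u v k with sides u v k
    ... | inj₂ (a , b) = (λ a′ → ⊥-elim (xs#ys a′ a)) , (λ b′ → ⊥-elim (xs#ys b′ b))
    ... | inj₁ (a , b) = (λ _ → b) , (λ _ → a)

walk-snoc : ∀ {A : Set} {_~_ : A → A → Set} {s xs t} → Walk _~_ s xs t →
            ∃[ ys ] s ∷ xs ≡ ys ++ [ t ]
walk-snoc nil = [] , refl
walk-snoc {s = s} (cons e w) = let (ys , eq) = walk-snoc w in s ∷ ys , cong (s ∷_) eq

∈-snoc⁻ : ∀ {A : Set} {v t : A} xs → v ∈ xs ++ [ t ] → v ≢ t → v ∈ xs
∈-snoc⁻ xs m v≢t with ∈-++⁻ xs m
... | inj₁ q = q
... | inj₂ (here eq) = ⊥-elim (v≢t eq)

-- The two pieces that remain of a path from a to b when its subpath between p and q, with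
-- interior I, is cut out.
record Remainder {A : Set} (_~_ : A → A → Set) (a b : A) (vs I : List A) (p q : A) : Set where
  field
    {l r} : List A
    left  : Walk _~_ a l p
    right : Walk _~_ b r q
    uniqˡ : Unique (a ∷ l)
    uniqʳ : Unique (b ∷ r)
    disj  : Disjoint (a ∷ l) (b ∷ r)
    ⊆ˡ    : ∀ {v} → v ∈ a ∷ l → v ∈ vs
    ⊆ʳ    : ∀ {v} → v ∈ b ∷ r → v ∈ vs
    ∉ˡ    : ∀ {v} → v ∈ a ∷ l → v ∉ I
    ∉ʳ    : ∀ {v} → v ∈ b ∷ r → v ∉ I

module _ {A : Set} {_~_ : A → A → Set} (sy : ∀ {u v} → u ~ v → v ~ u) where

  -- M is the subpath without p and N the subpath without q. M contains q, so it stays after p; N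
  -- contains p, so it stays before q; hence I lies strictly between. M and N are kept abstract
  -- because the subpath may run in either direction.
  remainder-ordered : ∀ {a b p q I M N} ys zs →
    Walk _~_ a ys p → Walk _~_ p zs b → q ∈ zs → Unique (a ∷ ys ++ zs) →
    (∀ u v → Consec M u v → EdgeIn (a ∷ ys ++ zs) u v) → p ∉ M → q ∈ M →
    (∀ u v → Consec N u v → EdgeIn (a ∷ ys ++ zs) u v) → q ∉ N → p ∈ N →
    (∀ {v} → v ∈ I → v ∈ M) → (∀ {v} → v ∈ I → v ∈ N) →
    Remainder _~_ a b (a ∷ ys ++ zs) I p q
  remainder-ordered {a} {b} {p} {q} {I} {M} {N} ys zs w₁ w₂ q∈zs unq linkM p∉M q∈M linkN q∉N p∈N I⊆M I⊆N
    with walk-at (there q∈zs) w₂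
  ... | ks , ms , refl , w₃ , w₄ with walk-reverse sy w₄ | walk-snoc w₁ | walk-snoc w₃
  ...   | r , r-eq , w₄′ | X , X-eq | Y , Y-eq = record
    { left = w₁ ; right = w₄′ ; uniqˡ = proj₁ parts
    ; uniqʳ = subst Unique (≡-sym r-eq) (unique-reverse (proj₁ (proj₂ (unique-++⁻ (X ++ Y) unq-q))))
    ; disj = λ (m , m′) → proj₂ (proj₂ parts) (m , q∷ms⊆ (from m′))
    ; ⊆ˡ = ∈-++⁺ˡ
    ; ⊆ʳ = λ m → ∈-++⁺ʳ (a ∷ ys) (q∷ms⊆ (from m))
    ; ∉ˡ = λ m v∈I → proj₂ (proj₂ parts) (m , stays-after unq-p p∉M (subst-edges eq-p linkM) q∈M q∈zs (I⊆M v∈I))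
    ; ∉ʳ = λ m v∈I → proj₂ (proj₂ (unique-++⁻ (X ++ Y) unq-q))
             (stays-before unq-q q∉N (subst-edges eq-q linkN) p∈N (∈-++⁺ʳ X p∈Y) (I⊆N v∈I) , from m) }
    where
    parts = unique-++⁻ (a ∷ ys) unq
    subst-edges : ∀ {xs xs′ L : List A} → xs ≡ xs′ → (∀ u v → Consec L u v → EdgeIn xs u v) →
                  ∀ u v → Consec L u v → EdgeIn xs′ u v
    subst-edges refl k = k
    eq-p : a ∷ ys ++ ks ++ ms ≡ X ++ p ∷ ks ++ ms
    eq-p = trans (cong (_++ (ks ++ ms)) X-eq) (++-assoc X [ p ] (ks ++ ms))
    eq-q : a ∷ ys ++ ks ++ ms ≡ (X ++ Y) ++ q ∷ ms
    eq-q = begin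
      a ∷ ys ++ ks ++ ms         ≡⟨ eq-p ⟩
      X ++ (p ∷ ks) ++ ms        ≡⟨ cong (λ l → X ++ l ++ ms) Y-eq ⟩
      X ++ (Y ++ [ q ]) ++ ms    ≡⟨ cong (X ++_) (++-assoc Y [ q ] ms) ⟩
      X ++ Y ++ q ∷ ms           ≡⟨ ++-assoc X Y (q ∷ ms) ⟨
      (X ++ Y) ++ q ∷ ms         ∎
    unq-p = subst Unique eq-p unq
    unq-q = subst Unique eq-q unq
    p≢q : p ≢ q
    p≢q refl = p∉M q∈M
    p∈Y : p ∈ Y
    p∈Y = ∈-snoc⁻ Y (subst (p ∈_) Y-eq (here refl)) p≢q
    q∈ks : q ∈ ks
    q∈ks = walk-last-≢ w₃ p≢q
    q∷ms⊆ : ∀ {v} → v ∈ q ∷ ms → v ∈ ks ++ ms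
    q∷ms⊆ (here refl) = ∈-++⁺ˡ q∈ks
    q∷ms⊆ (there m) = ∈-++⁺ʳ ks m
    from : ∀ {v} → v ∈ b ∷ r → v ∈ q ∷ ms
    from m = reverse⁻ (subst (_ ∈_) r-eq m)

  remainder : ∀ {a b p q I xs} → Walk _~_ a xs b → Unique (a ∷ xs) → Unique (p ∷ I ++ [ q ]) →
    (∀ v → v ∈ p ∷ I ++ [ q ] → v ∈ a ∷ xs) →
    (∀ u v → Consec (p ∷ I ++ [ q ]) u v → EdgeIn (a ∷ xs) u v) →
    Remainder _~_ a b (a ∷ xs) I p q ⊎ Remainder _~_ a b (a ∷ xs) I q p
  remainder {a} {b} {p} {q} {I} w unq unqP P⊆ linkP with walk-at (P⊆ p (here refl)) w
  ... | ys , zs , refl , w₁ , w₂ with ∈-++⁻ (a ∷ ys) (P⊆ q (there (∈-++⁺ʳ I (here refl))))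
  ...   | inj₂ q∈zs = inj₁ (remainder-ordered ys zs w₁ w₂ q∈zs unq
            (λ u v c → linkP u v (there c)) (Unique[x∷xs]⇒x∉xs unqP) (∈-++⁺ʳ I (here refl))
            (λ u v c → linkP u v (consec-++ c)) q∉ (here refl) ∈-++⁺ˡ there)
    where
    consec-++ : ∀ {u v xs} → Consec xs u v → Consec (xs ++ [ q ]) u v
    consec-++ here = here
    consec-++ (there c) = there (consec-++ c)
    q∉ : q ∉ p ∷ I
    q∉ m = proj₂ (proj₂ (unique-++⁻ (p ∷ I) unqP)) (m , here refl)
  ...   | inj₁ q∈ys with walk-at q∈ys w₁
  ...     | ys₁ , ys₂ , refl , w₃ , w₄ = inj₂ (subst (λ xs → Remainder _~_ a b (a ∷ xs) I q p) (≡-sym eq)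
            (remainder-ordered ys₁ (ys₂ ++ zs) w₃ (walk-++ w₄ w₂) (∈-++⁺ˡ p∈ys₂)
            (subst (λ xs → Unique (a ∷ xs)) eq unq)
            (λ u v c → link u v (consec-++ c)) q∉ (here refl)
            (λ u v c → link u v (there c)) (Unique[x∷xs]⇒x∉xs unqP) (∈-++⁺ʳ I (here refl))
            there ∈-++⁺ˡ))
    where
    eq = ++-assoc ys₁ ys₂ zs
    link : ∀ u v → Consec (p ∷ I ++ [ q ]) u v → EdgeIn (a ∷ ys₁ ++ ys₂ ++ zs) u v
    link = subst (λ xs → ∀ u v → Consec (p ∷ I ++ [ q ]) u v → EdgeIn (a ∷ xs) u v) eq linkP
    consec-++ : ∀ {u v xs} → Consec xs u v → Consec (xs ++ [ q ]) u v
    consec-++ here = here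
    consec-++ (there c) = there (consec-++ c)
    q∉ : q ∉ p ∷ I
    q∉ m = proj₂ (proj₂ (unique-++⁻ (p ∷ I) unqP)) (m , here refl)
    p∈ys₂ : p ∈ ys₂
    p∈ys₂ = walk-last-≢ w₄ λ { refl → q∉ (here refl) }

walk-of-list : ∀ {A : Set} {_~_ : A → A → Set} a xs b →
               (∀ u v → Consec (a ∷ xs ++ [ b ]) u v → u ~ v) → Walk _~_ a (xs ++ [ b ]) b
walk-of-list a [] b k = cons (k _ _ here) nil
walk-of-list a (x ∷ xs) b k = cons (k _ _ here) (walk-of-list x xs b (λ u v c → k u v (there c)))

-- Positions in a binary tree

root-not-below : ∀ {t} {x y : Pos t} → Child x y → ¬ InSub x here
root-not-below cU ()
root-not-below cL ()
root-not-below cR ()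
root-not-below (uU _) ()
root-not-below (uL _) ()
root-not-below (uR _) ()

parent-not-below : ∀ {t} {x y : Pos t} → Child x y → ¬ InSub x y
parent-not-below (uU c) (dU i) = parent-not-below c i
parent-not-below (uL c) (dL i) = parent-not-below c i
parent-not-below (uR c) (dR i) = parent-not-below c i
parent-not-below cU ()
parent-not-below cL ()
parent-not-below cR ()

parent : ∀ {t} (x : Pos t) → x ≡ here ⊎ ∃[ y ] Child x y
parent here = inj₁ refl
parent (inU x) with parent x
... | inj₁ refl = inj₂ (here , cU)
... | inj₂ (y , c) = inj₂ (inU y , uU c)
parent (inL x) with parent x
... | inj₁ refl = inj₂ (here , cL)
... | inj₂ (y , c) = inj₂ (inL y , uL c)
parent (inR x) with parent x
... | inj₁ refl = inj₂ (here , cR)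
... | inj₂ (y , c) = inj₂ (inR y , uR c)

sib-L⁻ : ∀ {l r} {x y : Pos l} {z : Pos (bi l r)} → Child x y → Sib (inL x) z →
         ∃[ x′ ] (z ≡ inL x′ × Sib x x′)
sib-L⁻ () sLR
sib-L⁻ c (tL s) = _ , refl , s

sib-R⁻ : ∀ {l r} {x y : Pos r} {z : Pos (bi l r)} → Child x y → Sib (inR x) z →
         ∃[ x′ ] (z ≡ inR x′ × Sib x x′)
sib-R⁻ () sRL
sib-R⁻ c (tR s) = _ , refl , s

sibling? : ∀ {t} (x : Pos t) → (∃[ x′ ] Sib x x′) ⊎ (∀ x′ → ¬ Sib x x′)
sibling? here = inj₂ λ _ ()
sibling? (inU x) with sibling? x
... | inj₁ (x′ , s) = inj₁ (inU x′ , tU s)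
... | inj₂ no-sib = inj₂ λ { _ (tU s) → no-sib _ s }
sibling? (inL x) with parent x
... | inj₁ refl = inj₁ (inR here , sLR)
... | inj₂ (_ , c) with sibling? x
...   | inj₁ (x′ , s) = inj₁ (inL x′ , tL s)
...   | inj₂ no-sib = inj₂ λ _ s → let (x′ , _ , s′) = sib-L⁻ c s in no-sib x′ s′
sibling? (inR x) with parent x
... | inj₁ refl = inj₁ (inL here , sRL)
... | inj₂ (_ , c) with sibling? x
...   | inj₁ (x′ , s) = inj₁ (inR x′ , tR s)
...   | inj₂ no-sib = inj₂ λ _ s → let (x′ , _ , s′) = sib-R⁻ c s in no-sib x′ s′

family₁ : ∀ {X : Set} {t} → X → (Pos t → X) → Pos (un t) → X
family₁ x F here = x
family₁ x F (inU z) = F z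

family₂ : ∀ {X : Set} {l r} → X → (Pos l → X) → (Pos r → X) → Pos (bi l r) → X
family₂ x F F′ here = x
family₂ x F F′ (inL z) = F z
family₂ x F F′ (inR z) = F′ z

-- This gives the rerouted spine its length of at least 2: e and the two feet of an ear are three
-- different vertices on it.
three-distinct : ∀ {A : Set} {xs : List A} {a u v w} → u ∈ a ∷ xs → v ∈ a ∷ xs → w ∈ a ∷ xs →
                 u ≢ v → u ≢ w → v ≢ w → 2 ≤ length xs
three-distinct {xs = _ ∷ _ ∷ _} _ _ _ _ _ _ = s≤s (s≤s z≤n)
three-distinct (here refl) (here refl) _ uv _ _ = ⊥-elim (uv refl)
three-distinct (here refl) _ (here refl) _ uw _ = ⊥-elim (uw refl)
three-distinct _ (here refl) (here refl) _ _ vw = ⊥-elim (vw refl)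
three-distinct {xs = _ ∷ []} (there (here refl)) (there (here refl)) _ uv _ _ = ⊥-elim (uv refl)
three-distinct {xs = _ ∷ []} (there (here refl)) _ (there (here refl)) _ uw _ = ⊥-elim (uw refl)
three-distinct {xs = _ ∷ []} _ (there (here refl)) (there (here refl)) _ _ vw = ⊥-elim (vw refl)

-- Ear trees in a contracted graph

module EarTrees (G : Graph) where

  open Contraction G public

  private
    A = V G

  -- The bare data of a path in the contracted graph, free of proofs so that `mapTrail` applies
  -- without any condition on the map.
  record Trail : Set where
    constructor trail
    field
      src  : A
      rest : List A
      tgt  : A

    vertices : List A
    vertices = src ∷ rest

  open Trail public

  mapTrail : (A → A) → Trail → Trail
  mapTrail g (trail s r t) = trail (g s) (map g r) (g t)

  Inner : A → Trail → Set
  Inner v X = v ∈ vertices X × v ≢ src X × v ≢ tgt X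

  record Proper (f : A → A) (X : Trail) : Set where
    field
      walk : Walk (Adj f) (src X) (rest X) (tgt X)
      uniq : Unique (vertices X)
      long : 2 ≤ length (rest X)

  -- A clean ear tree in the contracted graph, together with a region `W` that holds all its
  -- vertices except possibly the two ends of the root trail. Through `confined`, later contractions
  -- elsewhere are seen to be harmless.
  record EarTree (f : A → A) (t : BTree) (X : Pos t → Trail) (W : A → Set) : Set where
    field
      proper   : ∀ z → Proper f (X z)
      ends     : ∀ {x y} → Child x y → src (X x) ∈ vertices (X y) × tgt (X x) ∈ vertices (X y)
      apart    : ∀ {x y} → Child x y → ∀ {v} → Inner v (X x) → ∀ z → ¬ InSub x z → v ∉ vertices (X z)
      clean    : ∀ y → (∃[ x ] Child x y) →
                 ∃[ e ] ((e ≡ src (X y) ⊎ e ≡ tgt (X y)) × (∀ x → Child x y → e ∉ vertices (X x)))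
      confined : ∀ z {v} → v ∈ vertices (X z) → W v ⊎ v ≡ src (X here) ⊎ v ≡ tgt (X here)

    root-tgt : tgt (X here) ∈ vertices (X here)
    root-tgt = walk-last (Proper.walk (proper here))

    -- The exceptions in `confined` are ends of the root trail; these are not inner on the root
    -- trail, and inner vertices of lower trails avoid the root trail.
    inner⊆W : ∀ x {v} → Inner v (X x) → W v
    inner⊆W x i@(m , v≢s , v≢t) with confined x m
    ... | inj₁ w = w
    ... | inj₂ (inj₁ eq) with parent x
    ...   | inj₁ refl = ⊥-elim (v≢s eq)
    ...   | inj₂ (_ , c) = ⊥-elim (apart c i here (root-not-below c) (here eq))
    inner⊆W x i@(m , v≢s , v≢t) | inj₂ (inj₂ eq) with parent x
    ...   | inj₁ refl = ⊥-elim (v≢t eq)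
    ...   | inj₂ (_ , c) = ⊥-elim (apart c i here (root-not-below c)
              (subst (_∈ vertices (X here)) (≡-sym eq) root-tgt))

  -- g fixes `W` and sends the two root ends to different vertices outside `W`. By `confined` it is
  -- therefore injective on all vertices of the tree, and every condition carries over.
  map-tree : ∀ {f t X W} g → EarTree f t X W → (∀ {v} → W v → g v ≡ v) →
             g (src (X here)) ≢ g (tgt (X here)) →
             ¬ W (g (src (X here))) → ¬ W (g (tgt (X here))) →
             EarTree (g ∘ f) t (mapTrail g ∘ X) W
  map-tree {f} {t} {X} {W} g T fix s≢t s∉W t∉W = record
    { proper = λ z → let open Proper (proper z) in record
        { walk = walk-map g (λ p q a → adj-∘ g a λ eq → Adj.u≢v a (inj z z p q eq)) walk
        ; uniq = unique-map g (inj z z) uniq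
        ; long = subst (2 ≤_) (≡-sym (length-map g (rest (X z)))) long }
    ; ends = λ c → ∈-map⁺ g (proj₁ (ends c)) , ∈-map⁺ g (proj₂ (ends c))
    ; apart = λ { {x} c (m , n₁ , n₂) z below m′ → apart′ c (∈-map⁻ g m) n₁ n₂ z below (∈-map⁻ g m′) }
    ; clean = λ y c → let (e , e-end , off) = clean y c in
        g e , [ (λ eq → inj₁ (cong g eq)) , (λ eq → inj₂ (cong g eq)) ]′ e-end ,
        λ x c m → let (u , u∈ , eq) = ∈-map⁻ g m in
          off x c (subst (_∈ vertices (X x)) (≡-sym (inj y x (end∈ y e-end) u∈ eq)) u∈)
    ; confined = λ z m → let (u , u∈ , eq) = ∈-map⁻ g m in image eq (confined z u∈) }
    where
    open EarTree T
    region : A → Set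
    region v = W v ⊎ v ≡ src (X here) ⊎ v ≡ tgt (X here)
    inj′ : ∀ {u v} → region u → region v → g u ≡ g v → u ≡ v
    inj′ (inj₁ w) (inj₁ w′) eq = trans (≡-sym (fix w)) (trans eq (fix w′))
    inj′ (inj₁ w) (inj₂ (inj₁ refl)) eq = ⊥-elim (s∉W (subst W (trans (≡-sym (fix w)) eq) w))
    inj′ (inj₁ w) (inj₂ (inj₂ refl)) eq = ⊥-elim (t∉W (subst W (trans (≡-sym (fix w)) eq) w))
    inj′ (inj₂ (inj₁ refl)) (inj₁ w) eq = ⊥-elim (s∉W (subst W (trans (≡-sym (fix w)) (≡-sym eq)) w))
    inj′ (inj₂ (inj₂ refl)) (inj₁ w) eq = ⊥-elim (t∉W (subst W (trans (≡-sym (fix w)) (≡-sym eq)) w))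
    inj′ (inj₂ (inj₁ refl)) (inj₂ (inj₁ refl)) eq = refl
    inj′ (inj₂ (inj₁ refl)) (inj₂ (inj₂ refl)) eq = ⊥-elim (s≢t eq)
    inj′ (inj₂ (inj₂ refl)) (inj₂ (inj₁ refl)) eq = ⊥-elim (s≢t (≡-sym eq))
    inj′ (inj₂ (inj₂ refl)) (inj₂ (inj₂ refl)) eq = refl
    inj : ∀ z z′ {u v} → u ∈ vertices (X z) → v ∈ vertices (X z′) → g u ≡ g v → u ≡ v
    inj z z′ m m′ = inj′ (confined z m) (confined z′ m′)
    end∈ : ∀ y {e} → e ≡ src (X y) ⊎ e ≡ tgt (X y) → e ∈ vertices (X y)
    end∈ y (inj₁ eq) = here eq
    end∈ y (inj₂ refl) = walk-last (Proper.walk (proper y))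
    apart′ : ∀ {x y} → Child x y → ∀ {v} → ∃[ u ] (u ∈ vertices (X x) × v ≡ g u) →
             v ≢ g (src (X x)) → v ≢ g (tgt (X x)) → ∀ z → ¬ InSub x z →
             ¬ (∃[ u ] (u ∈ vertices (X z) × v ≡ g u))
    apart′ {x} c (u , u∈ , refl) n₁ n₂ z below (u′ , u′∈ , eq) with inj x z u∈ u′∈ eq
    ... | refl = apart c (u∈ , (λ { refl → n₁ refl }) , (λ { refl → n₂ refl })) z below u′∈
    image : ∀ {u v} → v ≡ g u → region u →
            W v ⊎ v ≡ g (src (X here)) ⊎ v ≡ g (tgt (X here))
    image eq (inj₁ w) = inj₁ (subst W (≡-sym (trans eq (fix w))) w)
    image eq (inj₂ (inj₁ refl)) = inj₂ (inj₁ eq)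
    image eq (inj₂ (inj₂ refl)) = inj₂ (inj₂ eq)

  -- A finished subtree resting on the trail R of its parent: only the ends of its root trail touch
  -- R, and both differ from e.
  record Grafted (f : A → A) (R : Trail) (e : A) (t : BTree) (X : Pos t → Trail) (W : A → Set) : Set where
    field
      tree : EarTree f t X W
      src∈ : src (X here) ∈ vertices R
      tgt∈ : tgt (X here) ∈ vertices R
      W∉R  : ∀ {v} → W v → v ∉ vertices R
      e∈R  : e ∈ vertices R
      e≢s  : e ≢ src (X here)
      e≢t  : e ≢ tgt (X here)

    open EarTree tree public

    located : ∀ z {v} → v ∈ vertices (X z) → W v ⊎ v ∈ vertices R
    located z m with confined z m
    ... | inj₁ w = inj₁ w
    ... | inj₂ (inj₁ refl) = inj₂ src∈
    ... | inj₂ (inj₂ refl) = inj₂ tgt∈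

    inner∉R : ∀ x {v} → Inner v (X x) → v ∉ vertices R
    inner∉R x i = W∉R (inner⊆W x i)

    e-off : e ∉ vertices (X here)
    e-off m with confined here m
    ... | inj₁ w = W∉R w e∈R
    ... | inj₂ (inj₁ eq) = e≢s eq
    ... | inj₂ (inj₂ eq) = e≢t eq

  module _ {f R e} {W : A → Set} (proper-R : Proper f R) (e-end : e ≡ src R ⊎ e ≡ tgt R)
           (R⊆ : ∀ {v} → v ∈ vertices R → W v ⊎ v ≡ src R ⊎ v ≡ tgt R) where

    graft₁ : ∀ {t X W₁} → Grafted f R e t X W₁ → (∀ {v} → W₁ v → W v) →
             EarTree f (un t) (family₁ R X) W
    graft₁ {t} {X} {W₁} B W₁⊆ = record
      { proper = λ { here → proper-R ; (inU z) → B.proper z }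
      ; ends = λ { cU → B.src∈ , B.tgt∈ ; (uU c) → B.ends c }
      ; apart = apart
      ; clean = λ { here _ → e , e-end , (λ { _ cU → B.e-off })
                  ; (inU y) (_ , uU c) → let (e′ , end , off) = B.clean y (_ , c) in
                      e′ , end , λ { _ (uU c) → off _ c } }
      ; confined = λ { here m → R⊆ m ; (inU z) m → [ (λ w → inj₁ (W₁⊆ w)) , R⊆ ]′ (B.located z m) } }
      where
      module B = Grafted B
      X′ = family₁ R X
      apart : ∀ {x y} → Child x y → ∀ {v} → Inner v (X′ x) → ∀ z → ¬ InSub x z → v ∉ vertices (X′ z)
      apart cU i here below = B.inner∉R here i
      apart cU i (inU z) below = ⊥-elim (below (dU top))
      apart (uU c) i here below = B.inner∉R _ i
      apart (uU c) i (inU z) below = B.apart c i z (λ b → below (dU b))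

    -- The regions of the two subtrees are disjoint, so the subtrees meet only on R. Inner vertices
    -- avoid R, which gives the ear condition across the subtrees.
    graft₂ : ∀ {t X W₁ t′ X′ W₂} → Grafted f R e t X W₁ → Grafted f R e t′ X′ W₂ →
             (∀ {v} → W₁ v → W v) → (∀ {v} → W₂ v → W v) → (∀ {v} → W₁ v → ¬ W₂ v) →
             EarTree f (bi t t′) (family₂ R X X′) W
    graft₂ {t} {X} {W₁} {t′} {X′} {W₂} B B′ W₁⊆ W₂⊆ W₁#W₂ = record
      { proper = λ { here → proper-R ; (inL z) → B.proper z ; (inR z) → B′.proper z }
      ; ends = λ { cL → B.src∈ , B.tgt∈ ; cR → B′.src∈ , B′.tgt∈
                 ; (uL c) → B.ends c ; (uR c) → B′.ends c }
      ; apart = apart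
      ; clean = λ { here _ → e , e-end , (λ { _ cL → B.e-off ; _ cR → B′.e-off })
                  ; (inL y) (_ , uL c) → let (e′ , end , off) = B.clean y (_ , c) in
                      e′ , end , λ { _ (uL c) → off _ c }
                  ; (inR y) (_ , uR c) → let (e′ , end , off) = B′.clean y (_ , c) in
                      e′ , end , λ { _ (uR c) → off _ c } }
      ; confined = λ { here m → R⊆ m
                     ; (inL z) m → [ (λ w → inj₁ (W₁⊆ w)) , R⊆ ]′ (B.located z m)
                     ; (inR z) m → [ (λ w → inj₁ (W₂⊆ w)) , R⊆ ]′ (B′.located z m) } }
      where
      module B = Grafted B
      module B′ = Grafted B′
      Y = family₂ R X X′
      across : ∀ x z {v} → Inner v (X x) → v ∉ vertices (X′ z)
      across x z i m = [ W₁#W₂ (B.inner⊆W x i) , B.inner∉R x i ]′ (B′.located z m)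
      across′ : ∀ x z {v} → Inner v (X′ x) → v ∉ vertices (X z)
      across′ x z i m = [ (λ w → W₁#W₂ w (B′.inner⊆W x i)) , B′.inner∉R x i ]′ (B.located z m)
      apart : ∀ {x y} → Child x y → ∀ {v} → Inner v (Y x) → ∀ z → ¬ InSub x z → v ∉ vertices (Y z)
      apart cL i here below = B.inner∉R here i
      apart cL i (inL z) below = ⊥-elim (below (dL top))
      apart cL i (inR z) below = across here z i
      apart cR i here below = B′.inner∉R here i
      apart cR i (inL z) below = across′ here z i
      apart cR i (inR z) below = ⊥-elim (below (dR top))
      apart (uL c) i here below = B.inner∉R _ i
      apart (uL c) i (inL z) below = B.apart c i z (λ b → below (dL b))
      apart (uL c) i (inR z) below = across _ z i
      apart (uR c) i here below = B′.inner∉R _ i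
      apart (uR c) i (inL z) below = across′ _ z i
      apart (uR c) i (inR z) below = B′.apart c i z (λ b → below (dR b))

sib-not-above-root : ∀ {t} {x x′ : Pos t} → Sib x x′ → ¬ InSub x′ here
sib-not-above-root sLR ()
sib-not-above-root sRL ()
sib-not-above-root (tU _) ()
sib-not-above-root (tL _) ()
sib-not-above-root (tR _) ()

-- Paths of G and their subpaths

module _ {G : Graph} where

  ∈I⇒∈V : ∀ (P : Path G) {v} → v ∈I P → v ∈V P
  ∈I⇒∈V P m = there (∈-++⁺ˡ m)

  end∈V : ∀ (P : Path G) {v} → IsEnd v P → v ∈V P
  end∈V P (inj₁ eq) = here eq
  end∈V P (inj₂ refl) = there (∈-++⁺ʳ (inner P) (here refl))

  ∈V-cases : ∀ (P : Path G) {v} → v ∈V P → v ∈I P ⊎ IsEnd v P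
  ∈V-cases P (here eq) = inj₂ (inj₁ eq)
  ∈V-cases P (there m) with ∈-++⁻ (inner P) m
  ... | inj₁ i = inj₁ i
  ... | inj₂ (here eq) = inj₂ (inj₂ eq)

  path-walk : (P : Path G) → Walk (E G) (start P) (inner P ++ [ end P ]) (end P)
  path-walk P = walk-of-list (start P) (inner P) (end P) (linked P)

  path-remainder : ∀ (P Q : Path G) → P ⊆P Q →
    Remainder (E G) (start Q) (end Q) (verts Q) (inner P) (start P) (end P) ⊎
    Remainder (E G) (start Q) (end Q) (verts Q) (inner P) (end P) (start P)
  path-remainder P Q (V⊆ , E⊆) =
    remainder (Contraction.E-sym G) (path-walk Q) (unique Q) (unique P) V⊆ E⊆

  -- An end of Q lies on one of the two pieces that remain when P is cut out, and these avoid the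
  -- interior of P.
  ∈I-⊆P : ∀ (P Q : Path G) → P ⊆P Q → ∀ {v} → v ∈I P → v ∈I Q
  ∈I-⊆P P Q P⊆Q m with ∈V-cases Q (proj₁ P⊆Q _ (∈I⇒∈V P m))
  ... | inj₁ i = i
  ... | inj₂ eq = ⊥-elim ([ (λ r → ends∉ r eq m) , (λ r → ends∉ r eq m) ]′ (path-remainder P Q P⊆Q))
    where
    ends∉ : ∀ {p q v} → Remainder (E G) (start Q) (end Q) (verts Q) (inner P) p q →
            IsEnd v Q → v ∉ inner P
    ends∉ r (inj₁ eq) = Remainder.∉ˡ r (here eq)
    ends∉ r (inj₂ eq) = Remainder.∉ʳ r (here eq)

-- Pear trees: tails, regions and restriction to subtrees

module PearTrees (G : Graph) where

  open EarTrees G public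

  private
    A = V G

  edge-adj : ∀ {f u v} → f u ≡ u → f v ≡ v → E G u v → Adj f u v
  edge-adj {u = u} fu fv e = adjacent fu fv e λ { refl → subst T (Graph.irr G u) e }

  walk-adj : ∀ {f s xs t} → (∀ {v} → v ∈ s ∷ xs → f v ≡ v) → Walk (E G) s xs t → Walk (Adj f) s xs t
  walk-adj fix = walk-⇒ λ p q → edge-adj (fix p) (fix q)

  module _ (R : Path G) (S : A → Set) (e : A) (e-end : IsEnd e R) where

    open Ears (start R) (end R) S e e-end

    path-spine : ∀ {f} → (∀ {v} → v ∈V R → f v ≡ v) → (∀ {v} → v ∈V R → S v) →
                 Spine f (inner R ++ [ end R ])
    path-spine fix ⊆S = record { walk = walk-adj fix (path-walk R) ; uniq = unique R ; ⊆S = ⊆S }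

    -- The pieces of Q outside P serve as the tails. They are swapped when P runs against Q, so that
    -- the first tail always leads to `start P`.
    ear-tails : ∀ {f} (P Q : Path G) → P ⊆P Q → IsEar Q R → ¬ (e ∈V Q) →
      (∀ {v} → v ∈V Q → ¬ (v ∈I P) → f v ≡ v) →
      (∀ {v} → v ∈I Q → ¬ (v ∈I P) → S v) →
      ∃[ a ] ∃[ l ] ∃[ b ] ∃[ r ] Tails f (inner R ++ [ end R ]) a l (start P) b r (end P)
    ear-tails {f} P Q P⊆Q (s∈R , t∈R , I∉R) e∉Q fix ⊆S =
      [ (λ rem → _ , _ , _ , _ , build rem) , (λ rem → _ , _ , _ , _ , swap (build rem)) ]′
        (path-remainder P Q P⊆Q)
      where
      build : ∀ {p q} (rem : Remainder (E G) (start Q) (end Q) (verts Q) (inner P) p q) →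
              Tails f (inner R ++ [ end R ]) (start Q) (Remainder.l rem) p (end Q) (Remainder.r rem) q
      build rem = record
        { left = record { foot = s∈R ; off = λ (m , m′) → I∉R _ (innerˡ m) m′
                        ; uniq = proj₁ (proj₂ (unique-++⁻ [ start Q ] uniqˡ))
                        ; walk = walk-adj (λ m → fix (⊆ˡ m) (∉ˡ m)) left }
        ; right = record { foot = t∈R ; off = λ (m , m′) → I∉R _ (innerʳ m) m′
                         ; uniq = proj₁ (proj₂ (unique-++⁻ [ end Q ] uniqʳ))
                         ; walk = walk-adj (λ m → fix (⊆ʳ m) (∉ʳ m)) right }
        ; disj = disj
        ; e≢a = λ eq → e∉Q (end∈V Q (inj₁ eq)) ; e≢b = λ eq → e∉Q (end∈V Q (inj₂ eq))
        ; l⊆S = λ m → ⊆S (innerˡ m) (∉ˡ (there m)) ; r⊆S = λ m → ⊆S (innerʳ m) (∉ʳ (there m)) }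
        where
        open Remainder rem
        innerˡ : ∀ {v} → v ∈ l → v ∈I Q
        innerˡ m with ∈V-cases Q (⊆ˡ (there m))
        ... | inj₁ i = i
        ... | inj₂ (inj₁ refl) = ⊥-elim (Unique[x∷xs]⇒x∉xs uniqˡ m)
        ... | inj₂ (inj₂ refl) = ⊥-elim (disj (there m , here refl))
        innerʳ : ∀ {v} → v ∈ r → v ∈I Q
        innerʳ m with ∈V-cases Q (⊆ʳ (there m))
        ... | inj₁ i = i
        ... | inj₂ (inj₁ refl) = ⊥-elim (disj (here refl , there m))
        ... | inj₂ (inj₂ refl) = ⊥-elim (Unique[x∷xs]⇒x∉xs uniqʳ m)

    -- A dummy second ear for a vertex with a single child: its tails consist of their feet alone,
    -- so `attach` handles one child in the same way as two.
    bare-tails : ∀ {f R a l p b r q} → Tails f R a l p b r q → Tails f R a [] a b [] b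
    bare-tails T = record
      { left = record { foot = Tail.foot left ; off = λ () ; uniq = [] ; walk = nil }
      ; right = record { foot = Tail.foot right ; off = λ () ; uniq = [] ; walk = nil }
      ; disj = λ { (here refl , here refl) → disj (here refl , here refl) }
      ; e≢a = e≢a ; e≢b = e≢b ; l⊆S = λ () ; r⊆S = λ () }
      where open Tails T

    -- The moves at y fix the region of the finished subtree and bring its root ends onto the spine,
    -- outside that region, as `map-tree` requires.
    graft : ∀ {f g R′ t X W} → Spine (g ∘ f) R′ → EarTree f t X W →
            Feet g R′ (src (X here)) (tgt (X here)) →
            (∀ {v} → W v → g v ≡ v) → (∀ {v} → W v → ¬ S v) →
            Grafted (g ∘ f) (trail (start R) R′ (end R)) e t (mapTrail g ∘ X) W
    graft {g = g} Sp T F fix W#S = record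
      { tree = map-tree g T fix p≢q (λ w → W∉ w p∈) (λ w → W∉ w q∈)
      ; src∈ = p∈ ; tgt∈ = q∈ ; W∉R = W∉ ; e∈R = Spine.e∈ Sp ; e≢s = e≢p ; e≢t = e≢q }
      where
      open Feet F
      W∉ : ∀ {v} → _ → v ∉ _
      W∉ w m = W#S w (Spine.⊆S Sp m)

    spine-proper : ∀ {f g R′ p q} → Spine f R′ → Feet g R′ p q →
                   Proper f (trail (start R) R′ (end R))
    spine-proper Sp F = record { walk = Spine.walk Sp ; uniq = Spine.uniq Sp
                               ; long = three-distinct (Spine.e∈ Sp) p∈ q∈ e≢p e≢q p≢q }
      where open Feet F

  Paths : BTree → Set
  Paths t = Pos t → Path G

  -- The vertices of the tree that only its own contractions may move: the ends of the root
  -- path, and the root's own Q, belong to the context.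
  Core : (t : BTree) → Paths t → Paths t → A → Set
  Core t P Q v = v ∈I P here ⊎ ∃[ x ] ∃[ y ] (Child x y × v ∈I Q x)

  -- The pear tree conditions with and without a sibling, brought into one form.
  avoid : ∀ {t} (P Q : Paths t) → IsPearTree G t P Q → ∀ {x y} → Child x y → ∀ {v} → v ∈I Q x →
          ∀ z → ¬ InSub x z → (∀ {x′} → Sib x x′ → ¬ InSub x′ z) → ¬ (v ∈V Q z)
  avoid _ _ (_ , pear) {x} c i z below below′ with sibling? x | pear _ _ c
  ... | inj₁ (x′ , s) | _ , _ , sib = proj₁ (sib x′ s) _ i z below (below′ s)
  ... | inj₂ no-sib | _ , nosib , _ = nosib no-sib _ i z below

  module Pear {t : BTree} (P Q : Paths t) (pear : IsPearTree G t P Q) where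

    P⊆Q : ∀ x → P x ⊆P Q x
    P⊆Q x = proj₂ (proj₂ (proj₁ pear x))

    ear : ∀ {x y} → Child x y → IsEar (Q x) (P y)
    ear c = proj₁ (proj₂ pear _ _ c)

  pear-U : ∀ {t} (P Q : Paths (un t)) → IsPearTree G (un t) P Q → IsPearTree G t (P ∘ inU) (Q ∘ inU)
  pear-U _ _ (sub , pear) = (λ x → sub (inU x)) , λ x y c →
    let (ear , nosib , sib) = pear (inU x) (inU y) (uU c) in
    ear ,
    (λ n v i z b → nosib (λ { _ (tU s) → n _ s }) v i (inU z) (λ { (dU b′) → b b′ })) ,
    (λ x′ s → let (p , q) = sib (inU x′) (tU s) in
      (λ v i z b b₁ → p v i (inU z) (λ { (dU b′) → b b′ }) (λ { (dU b′) → b₁ b′ })) , q)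

  pear-L : ∀ {l r} (P Q : Paths (bi l r)) → IsPearTree G (bi l r) P Q → IsPearTree G l (P ∘ inL) (Q ∘ inL)
  pear-L _ _ (sub , pear) = (λ x → sub (inL x)) , λ x y c →
    let (ear , nosib , sib) = pear (inL x) (inL y) (uL c) in
    ear ,
    (λ n v i z b → nosib (λ _ s → let (x′ , _ , s′) = sib-L⁻ c s in n x′ s′) v i (inL z)
                     (λ { (dL b′) → b b′ })) ,
    (λ x′ s → let (p , q) = sib (inL x′) (tL s) in
      (λ v i z b b₁ → p v i (inL z) (λ { (dL b′) → b b′ }) (λ { (dL b′) → b₁ b′ })) , q)

  pear-R : ∀ {l r} (P Q : Paths (bi l r)) → IsPearTree G (bi l r) P Q → IsPearTree G r (P ∘ inR) (Q ∘ inR)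
  pear-R _ _ (sub , pear) = (λ x → sub (inR x)) , λ x y c →
    let (ear , nosib , sib) = pear (inR x) (inR y) (uR c) in
    ear ,
    (λ n v i z b → nosib (λ _ s → let (x′ , _ , s′) = sib-R⁻ c s in n x′ s′) v i (inR z)
                     (λ { (dR b′) → b b′ })) ,
    (λ x′ s → let (p , q) = sib (inR x′) (tR s) in
      (λ v i z b b₁ → p v i (inR z) (λ { (dR b′) → b b′ }) (λ { (dR b′) → b₁ b′ })) , q)

  clean-U : ∀ {t} (P Q : Paths (un t)) → CleanPear G (un t) P Q → CleanPear G t (P ∘ inU) (Q ∘ inU)
  clean-U _ _ cl y (x , c) = let (e , end , off) = cl (inU y) (inU x , uU c) in
    e , end , λ x′ c′ → off (inU x′) (uU c′)

  clean-L : ∀ {l r} (P Q : Paths (bi l r)) → CleanPear G (bi l r) P Q → CleanPear G l (P ∘ inL) (Q ∘ inL)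
  clean-L _ _ cl y (x , c) = let (e , end , off) = cl (inL y) (inL x , uL c) in
    e , end , λ x′ c′ → off (inL x′) (uL c′)

  clean-R : ∀ {l r} (P Q : Paths (bi l r)) → CleanPear G (bi l r) P Q → CleanPear G r (P ∘ inR) (Q ∘ inR)
  clean-R _ _ cl y (x , c) = let (e , end , off) = cl (inR y) (inR x , uR c) in
    e , end , λ x′ c′ → off (inR x′) (uR c′)

  -- A vertex of `Q x` that is not inner is an end, hence lies on the path of the parent. Climbing
  -- in this way stops at an inner vertex of some Q or on the root path.
  Q⊆Core : ∀ t (P Q : Paths t) → IsPearTree G t P Q → ∀ {x y} → Child x y → ∀ {v} → v ∈V Q x →
           Core t P Q v ⊎ v ∈V P here
  Q⊆Core t P Q pear c m = [ (λ k → inj₁ (inj₂ k)) , inj₂ ]′ (go t P Q pear c m)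
    where
    direct : ∀ {t} (P Q : Paths t) → IsPearTree G t P Q → ∀ {x} → Child x here → ∀ {v} → v ∈V Q x →
             (∃[ x ] ∃[ y ] (Child x y × v ∈I Q x)) ⊎ v ∈V P here
    direct P Q pear {x} c m with ∈V-cases (Q x) m
    ... | inj₁ i = inj₁ (_ , _ , c , i)
    ... | inj₂ (inj₁ refl) = inj₂ (proj₁ (Pear.ear P Q pear c))
    ... | inj₂ (inj₂ refl) = inj₂ (proj₁ (proj₂ (Pear.ear P Q pear c)))
    go : ∀ t (P Q : Paths t) → IsPearTree G t P Q → ∀ {x y} → Child x y → ∀ {v} → v ∈V Q x →
         (∃[ x ] ∃[ y ] (Child x y × v ∈I Q x)) ⊎ v ∈V P here
    go _ P Q pear cU m = direct P Q pear cU m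
    go _ P Q pear cL m = direct P Q pear cL m
    go _ P Q pear cR m = direct P Q pear cR m
    go (un t) P Q pear (uU c) m with go t (P ∘ inU) (Q ∘ inU) (pear-U P Q pear) c m
    ... | inj₁ (_ , _ , c′ , i) = inj₁ (_ , _ , uU c′ , i)
    ... | inj₂ m′ = direct P Q pear cU (proj₁ (Pear.P⊆Q P Q pear (inU here)) _ m′)
    go (bi l r) P Q pear (uL c) m with go l (P ∘ inL) (Q ∘ inL) (pear-L P Q pear) c m
    ... | inj₁ (_ , _ , c′ , i) = inj₁ (_ , _ , uL c′ , i)
    ... | inj₂ m′ = direct P Q pear cL (proj₁ (Pear.P⊆Q P Q pear (inL here)) _ m′)
    go (bi l r) P Q pear (uR c) m with go r (P ∘ inR) (Q ∘ inR) (pear-R P Q pear) c m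
    ... | inj₁ (_ , _ , c′ , i) = inj₁ (_ , _ , uR c′ , i)
    ... | inj₂ m′ = direct P Q pear cR (proj₁ (Pear.P⊆Q P Q pear (inR here)) _ m′)

  -- `ι` embeds the subtree of one child. Its core `W` belongs to the core of the whole tree but
  -- misses the root path and the tails of the child, so the moves at the root leave it alone.
  module Branch {t t′ : BTree} (P Q : Paths t) (pear : IsPearTree G t P Q)
    (ι : Pos t′ → Pos t) (child : Child (ι here) here)
    (ι-child : ∀ {x y} → Child x y → Child (ι x) (ι y))
    (above : ∀ {x y} → Child x y → ∀ {v} → v ∈I Q (ι x) →
             ¬ (v ∈V Q here) × ¬ (v ∈V Q (ι here)))
    where

    open Pear P Q pear

    W : A → Set
    W = Core t′ (P ∘ ι) (Q ∘ ι)

    W⊆Core : ∀ {v} → W v → Core t P Q v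
    W⊆Core (inj₁ i) = inj₂ (_ , _ , child , ∈I-⊆P (P (ι here)) (Q (ι here)) (P⊆Q (ι here)) i)
    W⊆Core (inj₂ (_ , _ , c , i)) = inj₂ (_ , _ , ι-child c , i)

    W∉spine : ∀ {v} → W v → ¬ (v ∈V P here)
    W∉spine (inj₁ i) = proj₂ (proj₂ (ear child)) _ (∈I-⊆P (P (ι here)) (Q (ι here)) (P⊆Q (ι here)) i)
    W∉spine (inj₂ (_ , _ , c , i)) m = proj₁ (above c i) (proj₁ (P⊆Q here) _ m)

    -- The double negation is the form that refutes membership in a tail, which means being on Q and
    -- not in the interior of P.
    W∉tail : ∀ {v} → W v → v ∈V Q (ι here) → ¬ ¬ (v ∈I P (ι here))
    W∉tail (inj₁ i) _ n = n i
    W∉tail (inj₂ (_ , _ , c , i)) m _ = proj₂ (above c i) m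

-- Induction over the tree

module Unpear (G : Graph) where

  open PearTrees G

  private
    A = V G

  -- `f` collects the contractions made before the subtree is treated and `g` those made in it. The
  -- root path may be rerouted inside, but its ends stay.
  record Unpeared (f : A → A) (t : BTree) (P Q : Paths t) : Set where
    field
      {g}       : A → A
      {X}       : Pos t → Trail
      contracts : Contracts (g ∘ f)
      fixed     : ∀ {v} → ¬ Core t P Q v → g v ≡ v
      tree      : EarTree (g ∘ f) t X (Core t P Q)
      src≡      : src (X here) ≡ start (P here)
      tgt≡      : tgt (X here) ≡ end (P here)

  OnTail : Path G → Path G → A → Set
  OnTail P Q v = v ∈I Q × ¬ (v ∈I P)

  -- The subtrees are treated first, one after the other, and `attach` then acts at the root.
  -- Earlier contractions must fix the root path and every Q below the root; the root's own Q is
  -- left to its parent.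
  unpear : ∀ t (P Q : Paths t) {f} → IsPearTree G t P Q → CleanPear G t P Q → Contracts f →
           (∀ {v} → v ∈V P here → f v ≡ v) →
           (∀ {x y v} → Child x y → v ∈V Q x → f v ≡ v) →
           Unpeared f t P Q
  unpear lf P Q {f} pear clean C fixP fixQ = record
    { g = id
    ; X = λ _ → X
    ; contracts = C
    ; fixed = λ _ → refl
    ; tree = record
      { proper = λ _ → record
          { walk = walk-adj fixP (path-walk (P here)) ; uniq = unique (P here)
          ; long = subst (2 ≤_) (trans (+-comm 1 _) (≡-sym (length-++ (inner (P here))))) (proj₁ (proj₁ pear here)) }
      ; ends = λ ()
      ; apart = λ ()
      ; clean = λ { _ (_ , ()) }
      ; confined = λ { here m → [ (λ i → inj₁ (inj₁ i)) , inj₂ ]′ (∈V-cases (P here) m) } }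
    ; src≡ = refl
    ; tgt≡ = refl }
    where
    X : Trail
    X = trail (start (P here)) (inner (P here) ++ [ end (P here) ]) (end (P here))
  unpear (un t) P Q {f} pear clean C fixP fixQ = record
    { g = Y.g ∘ U.g
    ; X = family₁ (trail (start (P here)) Y.R (end (P here))) (mapTrail Y.g ∘ U.X)
    ; contracts = Y.contracts
    ; fixed = λ n → trans (cong Y.g (U.fixed (λ w → n (B.W⊆Core w))))
        (Y.fixed λ (s , ≢s , ≢t) → n (S⊆Core s ≢s ≢t))
    ; tree = graft₁ (spine-proper R S e e-end Y.spine Y.feet₁) e-end
        (λ m → S⊆ (Spine.⊆S Y.spine m))
        (graft R S e e-end Y.spine U.tree
          (subst₂ (Feet Y.g Y.R) (≡-sym U.src≡) (≡-sym U.tgt≡) Y.feet₁)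
          (λ w → Y.fixed λ (s , _) → W#S w s) W#S)
        B.W⊆Core
    ; src≡ = refl
    ; tgt≡ = refl }
    where
    R = P here
    c : Pos (un t)
    c = inU here
    open Pear P Q pear
    U = unpear t (P ∘ inU) (Q ∘ inU) (pear-U P Q pear) (clean-U P Q clean) C
          (λ m → fixQ cU (proj₁ (P⊆Q c) _ m)) (λ k → fixQ (uU k))
    module U = Unpeared U
    above : ∀ {x y} → Child x y → ∀ {v} → v ∈I Q (inU x) → ¬ (v ∈V Q here) × ¬ (v ∈V Q c)
    above k i =
      avoid P Q pear (uU k) i here (λ ()) (λ { (tU _) () }) ,
      avoid P Q pear (uU k) i c (λ { (dU b) → root-not-below k b })
        (λ { (tU s) (dU b) → sib-not-above-root s b })
    module B = Branch P Q pear inU cU uU above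
    cl = clean here (c , cU)
    e = proj₁ cl
    e-end = proj₁ (proj₂ cl)
    -- The interior of `P c` is left out of the tails: it belongs to the core of the subtree, which
    -- is already finished.
    S : A → Set
    S v = v ∈V R ⊎ OnTail (P c) (Q c) v
    W#S : ∀ {v} → B.W v → ¬ S v
    W#S w = [ B.W∉spine w , (λ (i , n) → B.W∉tail w (∈I⇒∈V (Q c) i) n) ]′
    S⊆ : ∀ {v} → S v → Core (un t) P Q v ⊎ v ≡ start R ⊎ v ≡ end R
    S⊆ (inj₁ m) = [ (λ i → inj₁ (inj₁ i)) , inj₂ ]′ (∈V-cases R m)
    S⊆ (inj₂ (i , _)) = inj₁ (inj₂ (_ , _ , cU , i))
    S⊆Core : ∀ {v} → S v → v ≢ start R → v ≢ end R → Core (un t) P Q v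
    S⊆Core s ≢s ≢t with S⊆ s
    ... | inj₁ k = k
    ... | inj₂ (inj₁ eq) = ⊥-elim (≢s eq)
    ... | inj₂ (inj₂ eq) = ⊥-elim (≢t eq)
    open Ears (start R) (end R) S e e-end
    tails = ear-tails R S e e-end (P c) (Q c) (P⊆Q c) (ear cU) (proj₂ (proj₂ cl) c cU)
      (λ m n → trans (cong U.g (fixQ cU m)) (U.fixed λ w → B.W∉tail w m n))
      (λ i n → inj₂ (i , n))
    cut = proj₂ (proj₂ (proj₂ (proj₂ tails)))
    Y = attach U.contracts
          (path-spine R S e e-end
            (λ m → trans (cong U.g (fixP m)) (U.fixed λ w → B.W∉spine w m)) inj₁)
          cut (bare-tails R S e e-end cut)
    module Y = Attached Y
  unpear (bi l r) P Q {f} pear clean C fixP fixQ = record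
    { g = Y.g ∘ U₂.g ∘ U₁.g
    ; X = family₂ (trail (start R) Y.R (end R)) (mapTrail Y.g ∘ mapTrail U₂.g ∘ U₁.X)
            (mapTrail Y.g ∘ U₂.X)
    ; contracts = Y.contracts
    ; fixed = λ n → trans (cong (Y.g ∘ U₂.g) (U₁.fixed (λ w → n (B₁.W⊆Core w))))
        (trans (cong Y.g (U₂.fixed (λ w → n (B₂.W⊆Core w))))
          (Y.fixed λ (s , ≢s , ≢t) → n (S⊆Core s ≢s ≢t)))
    ; tree = graft₂ (spine-proper R S e e-end Y.spine Y.feet₁) e-end
        (λ m → S⊆ (Spine.⊆S Y.spine m))
        (graft R S e e-end Y.spine tree₁
          (subst₂ (Feet Y.g Y.R) (≡-sym src₁) (≡-sym tgt₁) Y.feet₁)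
          (λ w → Y.fixed λ (s , _) → W₁#S w s) W₁#S)
        (graft R S e e-end Y.spine U₂.tree
          (subst₂ (Feet Y.g Y.R) (≡-sym U₂.src≡) (≡-sym U₂.tgt≡) Y.feet₂)
          (λ w → Y.fixed λ (s , _) → W₂#S w s) W₂#S)
        B₁.W⊆Core B₂.W⊆Core W₁#W₂
    ; src≡ = refl
    ; tgt≡ = refl }
    where
    R = P here
    c₁ c₂ : Pos (bi l r)
    c₁ = inL here
    c₂ = inR here
    open Pear P Q pear
    across₁ : ∀ {x y} → Child x y → ∀ {v} → v ∈I Q (inL x) → ∀ z → ¬ (v ∈V Q (inR z))
    across₁ k i z = avoid P Q pear (uL k) i (inR z) (λ ())
      λ s b → case-L (sib-L⁻ k s) b
      where
      case-L : ∀ {x : Pos l} {x′ : Pos (bi l r)} → ∃[ y ] (x′ ≡ inL y × Sib x y) → ¬ InSub x′ (inR z)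
      case-L (_ , refl , _) ()
    across₂ : ∀ {x y} → Child x y → ∀ {v} → v ∈I Q (inR x) → ∀ z → ¬ (v ∈V Q (inL z))
    across₂ k i z = avoid P Q pear (uR k) i (inL z) (λ ())
      λ s b → case-R (sib-R⁻ k s) b
      where
      case-R : ∀ {x : Pos r} {x′ : Pos (bi l r)} → ∃[ y ] (x′ ≡ inR y × Sib x y) → ¬ InSub x′ (inL z)
      case-R (_ , refl , _) ()
    P₁∉Q₂ : ∀ {v} → v ∈I P c₁ → ¬ (v ∈V Q c₂)
    P₁∉Q₂ = proj₂ (proj₂ (proj₂ (proj₂ pear c₁ here cL)) c₂ sLR) _
    P₂∉Q₁ : ∀ {v} → v ∈I P c₂ → ¬ (v ∈V Q c₁)
    P₂∉Q₁ = proj₂ (proj₂ (proj₂ (proj₂ pear c₂ here cR)) c₁ sRL) _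
    above₁ : ∀ {x y} → Child x y → ∀ {v} → v ∈I Q (inL x) → ¬ (v ∈V Q here) × ¬ (v ∈V Q c₁)
    above₁ k i =
      avoid P Q pear (uL k) i here (λ ()) sib-not-above-root ,
      avoid P Q pear (uL k) i c₁ (λ { (dL b) → root-not-below k b })
        (λ { (tL s) (dL b) → sib-not-above-root s b })
    module B₁ = Branch P Q pear inL cL uL above₁
    above₂ : ∀ {x y} → Child x y → ∀ {v} → v ∈I Q (inR x) → ¬ (v ∈V Q here) × ¬ (v ∈V Q c₂)
    above₂ k i =
      avoid P Q pear (uR k) i here (λ ()) sib-not-above-root ,
      avoid P Q pear (uR k) i c₂ (λ { (dR b) → root-not-below k b })
        (λ { (tR s) (dR b) → sib-not-above-root s b })
    module B₂ = Branch P Q pear inR cR uR above₂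
    -- Among the right subtree, the pear tree condition keeps the interior of `P c₁` off `Q c₂`
    -- only; the deeper Q are handled through `Q⊆Core`.
    W₁∉Q₂ : ∀ {v} → B₁.W v → ∀ z → ¬ (v ∈V Q (inR z))
    W₁∉Q₂ (inj₂ (_ , _ , k , i)) z m = across₁ k i z m
    W₁∉Q₂ (inj₁ i) z m with parent z
    ... | inj₁ refl = P₁∉Q₂ i m
    ... | inj₂ (_ , k) with Q⊆Core r (P ∘ inR) (Q ∘ inR) (pear-R P Q pear) k m
    ...   | inj₁ (inj₁ i′) = P₁∉Q₂ i (proj₁ (P⊆Q c₂) _ (∈I⇒∈V (P c₂) i′))
    ...   | inj₁ (inj₂ (_ , _ , k′ , i′)) = across₂ k′ i′ here (proj₁ (P⊆Q c₁) _ (∈I⇒∈V (P c₁) i))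
    ...   | inj₂ m′ = P₁∉Q₂ i (proj₁ (P⊆Q c₂) _ m′)
    W₂∉Q₁ : ∀ {v} → B₂.W v → ¬ (v ∈V Q c₁)
    W₂∉Q₁ (inj₁ i) = P₂∉Q₁ i
    W₂∉Q₁ (inj₂ (_ , _ , k , i)) = across₂ k i here
    W₁#W₂ : ∀ {v} → B₁.W v → ¬ B₂.W v
    W₁#W₂ w (inj₁ i) = W₁∉Q₂ w here (proj₁ (P⊆Q c₂) _ (∈I⇒∈V (P c₂) i))
    W₁#W₂ w (inj₂ (x , _ , _ , i)) = W₁∉Q₂ w x (∈I⇒∈V (Q (inR x)) i)
    U₁ = unpear l (P ∘ inL) (Q ∘ inL) (pear-L P Q pear) (clean-L P Q clean) C
           (λ m → fixQ cL (proj₁ (P⊆Q c₁) _ m)) (λ k → fixQ (uL k))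
    module U₁ = Unpeared U₁
    fix₁ : ∀ {v} → f v ≡ v → ¬ B₁.W v → U₁.g (f v) ≡ v
    fix₁ eq n = trans (cong U₁.g eq) (U₁.fixed n)
    -- The right subtree is treated on top of the contractions of the left one. These move only the
    -- left core, which meets no Q of the right subtree.
    U₂ = unpear r (P ∘ inR) (Q ∘ inR) (pear-R P Q pear) (clean-R P Q clean) U₁.contracts
           (λ m → let m′ = proj₁ (P⊆Q c₂) _ m in fix₁ (fixQ cR m′) (λ w → W₁∉Q₂ w here m′))
           (λ {x} k m → fix₁ (fixQ (uR k) m) (λ w → W₁∉Q₂ w x m))
    module U₂ = Unpeared U₂
    fix₂ : ∀ {v} → f v ≡ v → ¬ B₁.W v → ¬ B₂.W v → U₂.g (U₁.g (f v)) ≡ v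
    fix₂ eq n₁ n₂ = trans (cong U₂.g (fix₁ eq n₁)) (U₂.fixed n₂)
    U₂-fixes : ∀ {v} → v ∈V P c₁ → U₂.g v ≡ v
    U₂-fixes m = U₂.fixed λ w → W₂∉Q₁ w (proj₁ (P⊆Q c₁) _ m)
    src₁ : U₂.g (src (U₁.X here)) ≡ start (P c₁)
    src₁ = trans (cong U₂.g U₁.src≡) (U₂-fixes (end∈V (P c₁) (inj₁ refl)))
    tgt₁ : U₂.g (tgt (U₁.X here)) ≡ end (P c₁)
    tgt₁ = trans (cong U₂.g U₁.tgt≡) (U₂-fixes (end∈V (P c₁) (inj₂ refl)))
    W₁∌ends : ∀ {v} → IsEnd v (P c₁) → ¬ B₁.W v
    W₁∌ends eq w = B₁.W∉tail w (proj₁ (P⊆Q c₁) _ (end∈V (P c₁) eq)) (end∉I eq)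
      where
      end∉I : ∀ {v} → IsEnd v (P c₁) → ¬ (v ∈I P c₁)
      end∉I (inj₁ refl) i = Unique[x∷xs]⇒x∉xs (unique (P c₁)) (∈-++⁺ˡ i)
      end∉I (inj₂ refl) i = proj₂ (proj₂ (unique-++⁻ (start (P c₁) ∷ inner (P c₁)) (unique (P c₁))))
                              (there i , here refl)
    -- The left tree was built before the contractions of the right one and is carried along them;
    -- they move only the right core, which misses both the left core and the ends of `P c₁`.
    tree₁ : EarTree (U₂.g ∘ U₁.g ∘ f) l (mapTrail U₂.g ∘ U₁.X) B₁.W
    tree₁ = map-tree U₂.g U₁.tree (λ w → U₂.fixed (W₁#W₂ w))
      (λ eq → start≢end (trans (≡-sym src₁) (trans eq tgt₁)))
      (λ w → W₁∌ends (inj₁ src₁) w) (λ w → W₁∌ends (inj₂ tgt₁) w)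
      where
      start≢end : start (P c₁) ≢ end (P c₁)
      start≢end eq = Unique[x∷xs]⇒x∉xs (unique (P c₁)) (∈-++⁺ʳ (inner (P c₁)) (here eq))
    cl = clean here (c₁ , cL)
    e = proj₁ cl
    e-end = proj₁ (proj₂ cl)
    S : A → Set
    S v = v ∈V R ⊎ OnTail (P c₁) (Q c₁) v ⊎ OnTail (P c₂) (Q c₂) v
    W₁#S : ∀ {v} → B₁.W v → ¬ S v
    W₁#S w = [ B₁.W∉spine w , [ (λ (i , n) → B₁.W∉tail w (∈I⇒∈V (Q c₁) i) n)
                             , (λ (i , _) → W₁∉Q₂ w here (∈I⇒∈V (Q c₂) i)) ]′ ]′
    W₂#S : ∀ {v} → B₂.W v → ¬ S v
    W₂#S w = [ B₂.W∉spine w , [ (λ (i , _) → W₂∉Q₁ w (∈I⇒∈V (Q c₁) i))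
                             , (λ (i , n) → B₂.W∉tail w (∈I⇒∈V (Q c₂) i) n) ]′ ]′
    S⊆ : ∀ {v} → S v → Core (bi l r) P Q v ⊎ v ≡ start R ⊎ v ≡ end R
    S⊆ (inj₁ m) = [ (λ i → inj₁ (inj₁ i)) , inj₂ ]′ (∈V-cases R m)
    S⊆ (inj₂ (inj₁ (i , _))) = inj₁ (inj₂ (_ , _ , cL , i))
    S⊆ (inj₂ (inj₂ (i , _))) = inj₁ (inj₂ (_ , _ , cR , i))
    S⊆Core : ∀ {v} → S v → v ≢ start R → v ≢ end R → Core (bi l r) P Q v
    S⊆Core s ≢s ≢t with S⊆ s
    ... | inj₁ k = k
    ... | inj₂ (inj₁ eq) = ⊥-elim (≢s eq)
    ... | inj₂ (inj₂ eq) = ⊥-elim (≢t eq)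
    open Ears (start R) (end R) S e e-end
    tails₁ = ear-tails R S e e-end (P c₁) (Q c₁) (P⊆Q c₁) (ear cL) (proj₂ (proj₂ cl) c₁ cL)
      (λ m n → fix₂ (fixQ cL m) (λ w → B₁.W∉tail w m n) (λ w → W₂∉Q₁ w m))
      (λ i n → inj₂ (inj₁ (i , n)))
    tails₂ = ear-tails R S e e-end (P c₂) (Q c₂) (P⊆Q c₂) (ear cR) (proj₂ (proj₂ cl) c₂ cR)
      (λ m n → fix₂ (fixQ cR m) (λ w → W₁∉Q₂ w here m) (λ w → B₂.W∉tail w m n))
      (λ i n → inj₂ (inj₂ (i , n)))
    Y = attach U₂.contracts
          (path-spine R S e e-end
            (λ m → fix₂ (fixP m) (λ w → B₁.W∉spine w m) (λ w → B₂.W∉spine w m)) inj₁)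
          (proj₂ (proj₂ (proj₂ (proj₂ tails₁)))) (proj₂ (proj₂ (proj₂ (proj₂ tails₂))))
    module Y = Attached Y

-- The contracted graph as a minor

walk-consec : ∀ {A : Set} {_~_ : A → A → Set} {s xs t} → Walk _~_ s xs t →
              ∀ {u v} → Consec (s ∷ xs) u v → u ~ v
walk-consec (cons a w) here = a
walk-consec (cons a w) (there c) = walk-consec w c

-- Graphs have vertex sets `Fin m`, so the image of a contraction must be numbered: `h zero`
-- receives a new number only when its value has none yet.
image-factorisation : ∀ {n} {B : Set} → DecidableEquality B → (h : Fin n → B) →
  ∃[ m ] Σ (Fin n → Fin m) λ π → Σ (Fin m → B) λ ι →
    (∀ a → h a ≡ ι (π a)) × (∀ i j → ι i ≡ ι j → i ≡ j) × (∀ i → ∃[ a ] π a ≡ i)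
image-factorisation {zero} _ h = 0 , (λ ()) , (λ ()) , (λ ()) , (λ ()) , λ ()
image-factorisation {suc n} _≟B_ h with image-factorisation _≟B_ (h ∘ suc)
... | m , π , ι , factor , inj , surj with any? (λ i → ι i ≟B h zero)
...   | yes (i , eq) = m , (λ { zero → i ; (suc a) → π a }) , ι ,
  (λ { zero → ≡-sym eq ; (suc a) → factor a }) , inj ,
  λ j → let (a , p) = surj j in suc a , p
...   | no fresh = suc m , (λ { zero → zero ; (suc a) → suc (π a) }) ,
  (λ { zero → h zero ; (suc i) → ι i }) ,
  (λ { zero → refl ; (suc a) → factor a }) ,
  (λ { zero zero _ → refl ; zero (suc j) eq → ⊥-elim (fresh (j , ≡-sym eq))
     ; (suc i) zero eq → ⊥-elim (fresh (i , eq)) ; (suc i) (suc j) eq → cong suc (inj i j eq) }) ,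
  λ { zero → zero , refl ; (suc i) → let (a , p) = surj i in suc a , cong suc p }

quotient : (G : Graph) {m : ℕ} → (V G → Fin m) → Graph
quotient G {m} π = record { n = m ; adj = λ u w → ⌊ joined? u w ⌋ ; sym = symm ; irr = irrefl }
  where
  Joined : Fin m → Fin m → Set
  Joined u w = u ≢ w × ∃[ a ] ∃[ b ] (π a ≡ u × π b ≡ w × E G a b)
  joined? : ∀ u w → Dec (Joined u w)
  joined? u w = ¬? (u ≟ w) ×-dec
    any? λ a → any? λ b → π a ≟ u ×-dec π b ≟ w ×-dec T? (adj G a b)
  flip : ∀ {u w} → Joined u w → Joined w u
  flip (ne , a , b , p , q , e) = (λ eq → ne (≡-sym eq)) , b , a , q , p , Contraction.E-sym G e
  symm : ∀ u w → ⌊ joined? u w ⌋ ≡ ⌊ joined? w u ⌋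
  symm u w with joined? u w | joined? w u
  ... | yes _ | yes _ = refl
  ... | no _ | no _ = refl
  ... | yes j | no nj = ⊥-elim (nj (flip j))
  ... | no nj | yes j = ⊥-elim (nj (flip j))
  irrefl : ∀ v → ⌊ joined? v v ⌋ ≡ false
  irrefl v with joined? v v
  ... | yes (ne , _) = ⊥-elim (ne refl)
  ... | no _ = refl

module Quotient (G : Graph) {f : V G → V G} (C : Contraction.Contracts G f) where

  open EarTrees G
  open Contracts C

  private
    factorisation = image-factorisation (_≟_ {n G}) f
    π = proj₁ (proj₂ factorisation)
    ι = proj₁ (proj₂ (proj₂ factorisation))
    f≡ι∘π = proj₁ (proj₂ (proj₂ (proj₂ factorisation)))
    ι-injective = proj₁ (proj₂ (proj₂ (proj₂ (proj₂ factorisation))))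
    π-surjective = proj₂ (proj₂ (proj₂ (proj₂ (proj₂ factorisation))))

  H : Graph
  H = quotient G π

  minor : H ≼ G
  minor = record
    -- Every vertex of G belongs to a branch set, since vertices are contracted and never deleted.
    { φ = λ a → just (π a)
    ; nonempty = λ u → let (a , p) = π-surjective u in a , cong just p
    ; connected = λ u a b p q → walkIn-⇒ (λ {c} fc≡ → cong just (π≡ fc≡))
        (connected (ι u) a b (f≡ p) (f≡ q))
    ; edges = λ u w e → let (_ , a , b , p , q , e′) = toWitness e in
        a , b , cong just p , cong just q , e′ }
    where
    f≡ : ∀ {a u} → just (π a) ≡ just u → f a ≡ ι u
    f≡ {a} refl = f≡ι∘π a
    π≡ : ∀ {c u} → f c ≡ ι u → π c ≡ u
    π≡ {c} eq = ι-injective _ _ (trans (≡-sym (f≡ι∘π c)) eq)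

  π-injective : ∀ {u v} → f u ≡ u → f v ≡ v → π u ≡ π v → u ≡ v
  π-injective {u} {v} fu fv eq =
    trans (≡-sym fu) (trans (f≡ι∘π u) (trans (cong ι eq) (trans (≡-sym (f≡ι∘π v)) fv)))

  adj-fixed : ∀ {u v} → Adj f u v → f u ≡ u
  adj-fixed (adjacent {a} fa≡u _ _ _) = trans (cong f (≡-sym fa≡u)) (trans (idem a) fa≡u)

  -- A vertex with a neighbour in the contracted graph lies in the image of f, so idempotence fixes
  -- it. The walk must have an edge, since a single vertex carries no such evidence.
  walk-fixed : ∀ {s x xs t} → Walk (Adj f) s (x ∷ xs) t → ∀ {v} → v ∈ s ∷ x ∷ xs → f v ≡ v
  walk-fixed (cons e w) (here refl) = adj-fixed e
  walk-fixed (cons e nil) (there (here refl)) = adj-fixed (adj-sym e)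
  walk-fixed (cons e w@(cons _ _)) (there m) = walk-fixed w m

  adj⇒E : ∀ {u v} → Adj f u v → E H (π u) (π v)
  adj⇒E a@(adjacent {x} {y} fx≡u fy≡v e u≢v) =
    fromWitness ((λ eq → u≢v (π-injective (adj-fixed a) (adj-fixed (adj-sym a)) eq)) ,
      x , y , same fx≡u , same fy≡v , e)
    where
    same : ∀ {x u} → f x ≡ u → π x ≡ π u
    same {x} refl = ι-injective _ _ (trans (≡-sym (f≡ι∘π x)) (trans (≡-sym (idem x)) (f≡ι∘π (f x))))

  private
    proper-fixed : ∀ {X} → Proper f X → ∀ {v} → v ∈ vertices X → f v ≡ v
    proper-fixed {trail _ (_ ∷ _) _} pr = walk-fixed (Proper.walk pr)

    image-path : ∀ X → Proper f X → Σ (Path H) λ P →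
      start P ≡ π (src X) × end P ≡ π (tgt X) × verts P ≡ map π (vertices X)
    image-path (trail s (x ∷ r) t) pr with Proper.walk pr
    ... | w@(cons _ w′) = record
      { start = π s ; inner = map π (proj₁ last) ; end = π t
      ; unique = subst Unique (≡-sym vs) (unique-map π
          (λ p q → π-injective (proper-fixed pr p) (proper-fixed pr q)) (Proper.uniq pr))
      ; linked = λ u v c → walk-consec (walk-map π (λ _ _ → adj⇒E) w)
          (subst (λ l → Consec l u v) vs c) } ,
      refl , refl , vs
      where
      last = walk-snoc w′
      vs : π s ∷ map π (proj₁ last) ++ [ π t ] ≡ π s ∷ map π (x ∷ r)
      vs = cong (π s ∷_) (trans (≡-sym (map-++ π (proj₁ last) [ t ])) (cong (map π) (≡-sym (proj₂ last))))

  module _ {t : BTree} {X : Pos t → Trail} {W : V G → Set} (tree : EarTree f t X W) where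

    open EarTree tree

    paths : Pos t → Path H
    paths z = proj₁ (image-path (X z) (proper z))

    private
      start≡ : ∀ z → start (paths z) ≡ π (src (X z))
      start≡ z = proj₁ (proj₂ (image-path (X z) (proper z)))
      end≡ : ∀ z → end (paths z) ≡ π (tgt (X z))
      end≡ z = proj₁ (proj₂ (proj₂ (image-path (X z) (proper z))))
      verts≡ : ∀ z → verts (paths z) ≡ map π (vertices (X z))
      verts≡ z = proj₂ (proj₂ (proj₂ (image-path (X z) (proper z))))

      ∈V⁺ : ∀ z {v} → v ∈ vertices (X z) → π v ∈V paths z
      ∈V⁺ z {v} m = subst (π v ∈_) (≡-sym (verts≡ z)) (∈-map⁺ π m)

      ∈V⁻ : ∀ z {v} → π v ∈V paths z → f v ≡ v → v ∈ vertices (X z)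
      ∈V⁻ z {v} m fv with ∈-map⁻ π (subst (π v ∈_) (verts≡ z) m)
      ... | u , u∈ , eq = subst (_∈ vertices (X z))
        (≡-sym (π-injective fv (proper-fixed (proper z) u∈) eq)) u∈

      ∈I⁻ : ∀ z {v} → v ∈I paths z → ∃[ u ] (v ≡ π u × f u ≡ u × Inner u (X z))
      ∈I⁻ z {v} m with ∈-map⁻ π (subst (v ∈_) (verts≡ z) (∈I⇒∈V (paths z) m))
      ... | u , u∈ , refl = u , refl , proper-fixed (proper z) u∈ , u∈ ,
        (λ { refl → Unique[x∷xs]⇒x∉xs (unique (paths z))
              (∈-++⁺ˡ (subst (_∈ inner (paths z)) (≡-sym (start≡ z)) m)) }) ,
        (λ { refl → proj₂ (proj₂ (unique-++⁻ (verts-but-last z) (unique (paths z))))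
              (there m , here (≡-sym (end≡ z))) })
        where
        verts-but-last : ∀ z → List (V H)
        verts-but-last z = start (paths z) ∷ inner (paths z)

      length≡ : ∀ z → len (paths z) ≡ length (rest (X z))
      length≡ z = suc-injective (begin
        suc (len (paths z))                      ≡⟨ cong suc (+-comm 1 (length (inner (paths z)))) ⟩
        suc (length (inner (paths z)) + 1)       ≡⟨ cong suc (length-++ (inner (paths z))) ⟨
        length (verts (paths z))                 ≡⟨ cong length (verts≡ z) ⟩
        length (map π (vertices (X z)))          ≡⟨ length-map π (vertices (X z)) ⟩
        suc (length (rest (X z)))                ∎)

    ear-tree : IsEarTree H t paths
    ear-tree = (λ z → subst (2 ≤_) (≡-sym (length≡ z)) (Proper.long (proper z))) , λ x y c →
      ( subst (_∈V paths y) (≡-sym (start≡ x)) (∈V⁺ y (proj₁ (ends c)))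
      , subst (_∈V paths y) (≡-sym (end≡ x)) (∈V⁺ y (proj₂ (ends c)))
      , λ v i → off c i y (parent-not-below c)) ,
      λ v i z below → off c i z below
      where
      off : ∀ {x y} → Child x y → ∀ {v} → v ∈I paths x → ∀ z → ¬ InSub x z → ¬ (v ∈V paths z)
      off {x} c i z below m with ∈I⁻ x i
      ... | u , refl , fu , inn = apart c inn z below (∈V⁻ z m fu)

    clean-ear : CleanEar H t paths
    clean-ear y child with clean y child
    ... | e , e-end , off = π e ,
      [ (λ { refl → inj₁ (≡-sym (start≡ y)) }) , (λ { refl → inj₂ (≡-sym (end≡ y)) }) ]′ e-end ,
      λ x c m → off x c (∈V⁻ x m (proper-fixed (proper y) (e∈ e-end)))
      where
      e∈ : ∀ {e} → e ≡ src (X y) ⊎ e ≡ tgt (X y) → e ∈ vertices (X y)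
      e∈ (inj₁ eq) = here eq
      e∈ (inj₂ refl) = walk-last (Proper.walk (proper y))

-- From the pear tree, starting with no contraction, to the ear tree in the quotient

theorem4p1 : (G : Graph) (t : BTree) (P Q : Pos t → Path G) →
    IsPearTree G t P Q → CleanPear G t P Q →
    ∃[ H ] (H ≼ G × ∃[ P′ ] (IsEarTree H t P′ × CleanEar H t P′))
theorem4p1 G t P Q pear clean =
  H , minor , paths tree , ear-tree tree , clean-ear tree
  where
  open Contraction G using (Contracts)
  id-contracts : Contracts id
  id-contracts = record { idem = λ _ → refl ; connected = λ { _ _ _ refl refl → stop refl } }
  U = Unpear.unpear G t P Q pear clean id-contracts (λ _ → refl) (λ _ _ → refl)
  open Unpear.Unpeared U using (contracts; tree)
  open Quotient G contracts
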